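{- For $n\ge 0$, let $a_n=-1$ when $n=2^j$ for some integer $j\ge 0$, and let $a_n=1$ otherwise. Write \[ F(x)=\sum_{n\ge 0}a_nx^n,\qquad F(x)^4=\sum_{n\ge 0}c(n)x^n . \] Then the sequence $(a_n)_{n\ge 0}$ is $2$-automatic, every $c(n)$ ($n\ge 0$) is nonzero, and the sequence $(\omega(n))_{n\ge 0}$ of residues \[ \omega(n)=\operatorname{odd}(c(n)) \pmod 4 \] is not $2$-automatic.
   Context: For a nonzero integer $a$, $\nu_2(a)$ is the largest integer $v$ such that $2^v$ divides $a$, and the signed odd part is $\operatorname{odd}(a)=a/2^{\nu_2(a)}$; also $\operatorname{odd}(0)=0$. A sequence $(a_n)_{n\ge 0}$ with values in a finite set is $2$-automatic if there is a finite automaton which, reading the binary expansion of $n$ from the most significant digit, outputs $a_n$; equivalently, its $2$-kernel $\{(a_{2^e n+c})_{n\ge 0}: e\ge 0,\ 0\le c<2^e\}$ is finite. -}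

module Defs where

open import Data.Bool.Base using (if_then_else_)
open import Data.Digit using (Bit; 0b; 1b)
open import Data.Fin.Base using (Fin; zero; suc; toℕ; fromℕ<)
open import Data.Integer.Base using (ℤ; +_; -[1+_]; 0ℤ; 1ℤ; -1ℤ; ∣_∣; _*_; _/ℕ_; _%ℕ_; NonZero)
open import Data.Integer.DivMod using (n%ℕd<d)
open import Data.Integer.Divisibility using (_∣_)
open import Data.Integer.Properties using (+-0-monoid)
open import Data.List.Base using (List; []; _∷_; foldl; reverse)
open import Data.Nat.Base using (ℕ; zero; suc; _^_; _∸_; _≤_; _<_; z<s; s≤s⁻¹)
open import Data.Nat.Divisibility using (_∣?_; ∣⇒≤; 1∣_)
open import Data.Nat.Properties as ℕ using (_≟_; anyUpTo?; m^n≢0)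
open import Data.Product.Base using (∃; _×_; _,_; proj₁)
open import Relation.Binary.PropositionalEquality using (_≡_; refl)
open import Relation.Nullary using (Dec; yes; no)
open import Relation.Nullary.Decidable using (map′; does)
open import Algebra.Properties.Monoid.Sum +-0-monoid using (sum⁺-syntax)

n<2^n : ∀ n → n < 2 ^ n
n<2^n zero    = z<s
n<2^n (suc n) = ℕ.+-mono-≤-< (ℕ.m^n>0 2 n) (ℕ.<-≤-trans (n<2^n n) (ℕ.m≤m+n (2 ^ n) 0))

powerOf2? : ∀ n → Dec (∃ λ j → n ≡ 2 ^ j)
powerOf2? n = map′ (λ (j , _ , eq) → j , eq)
                   (λ { (j , refl) → j , n<2^n j , refl })
                   (anyUpTo? (λ j → n ≟ 2 ^ j) n)

-- The coefficient sequence of the formal power series  Σ f(n) xⁿ.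
Series : Set
Series = ℕ → ℤ

infixl 7 _⊛_
infixr 8 _^ˢ_

-- ∑[ k ≤ n ]  has its bound variable in Fin (suc n).
_⊛_ : Series → Series → Series
(f ⊛ g) n = ∑[ k ≤ n ] (f (toℕ k) * g (n ∸ toℕ k))

1ˢ : Series
1ˢ zero    = 1ℤ
1ˢ (suc _) = 0ℤ

_^ˢ_ : Series → ℕ → Series
f ^ˢ zero  = 1ˢ
f ^ˢ suc k = f ⊛ (f ^ˢ k)

a : ℕ → ℤ
a n = if does (powerOf2? n) then -1ℤ else 1ℤ

c : ℕ → ℤ
c = a ^ˢ 4

IsMaximum : (ℕ → Set) → ℕ → Set
IsMaximum P v = P v × (∀ w → P w → w ≤ v)

private
  maxUpTo : {P : ℕ → Set} → (∀ n → Dec (P n)) → P 0 →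
            ∀ b → ∃ λ v → P v × (∀ w → w ≤ b → P w → w ≤ v)
  maxUpTo P? p₀ zero = zero , p₀ , λ w w≤0 _ → w≤0
  maxUpTo {P} P? p₀ (suc b) with P? (suc b) | maxUpTo P? p₀ b
  ... | yes p | _             = suc b , p , λ _ w≤ _ → w≤
  ... | no ¬p | v , pv , vmax = v , pv , λ w w≤ pw →
    vmax w (s≤s⁻¹ (ℕ.≤∧≢⇒< w≤ λ { refl → ¬p pw })) pw

-- 2 ^ w ∣ z ≢ 0 forces w < 2 ^ w ≤ ∣ z ∣, so a search up to ∣ z ∣ is
-- exhaustive.
twoAdicOrder : (z : ℤ) .{{_ : NonZero z}} → ∃ (IsMaximum λ v → + (2 ^ v) ∣ z)
twoAdicOrder z with maxUpTo (λ v → 2 ^ v ∣? ∣ z ∣) (1∣ ∣ z ∣) ∣ z ∣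
... | v , pv , vmax = v , pv , λ w pw →
  vmax w (ℕ.≤-trans (ℕ.<⇒≤ (n<2^n w)) (∣⇒≤ pw)) pw

ν₂ : (z : ℤ) .{{_ : NonZero z}} → ℕ
ν₂ z = proj₁ (twoAdicOrder z)

-- The division is exact, so the rounding convention of _/ℕ_ for
-- negative dividends plays no role and the sign of z is kept.
odd : ℤ → ℤ
odd (+ zero)        = 0ℤ
odd z@(+ (suc _))   = _/ℕ_ z (2 ^ ν₂ z) {{m^n≢0 2 (ν₂ z)}}
odd z@(-[1+ _ ])    = _/ℕ_ z (2 ^ ν₂ z) {{m^n≢0 2 (ν₂ z)}}

-- _%ℕ_ is the non-negative residue, so -1 has residue 3.
ω : ℕ → Fin 4
ω n = fromℕ< {odd (c n) %ℕ 4} (n%ℕd<d (odd (c n)) 4)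

-- A deterministic finite automaton with output.  Since out has finite
-- range, so does every sequence such an automaton computes.
record DFAO (A : Set) : Set where
  field
    states : ℕ
    start  : Fin states
    step   : Fin states → Bit → Fin states
    out    : Fin states → A

  run : List Bit → A
  run w = out (foldl step start w)

increment : List Bit → List Bit
increment []              = 1b ∷ []
increment (zero     ∷ ds) = 1b ∷ ds
increment (suc zero ∷ ds) = 0b ∷ increment ds

-- Least significant digit first.
bits : ℕ → List Bit
bits zero    = []
bits (suc n) = increment (bits n)

-- Most significant digit first and without leading zeros; 0 is the
-- empty word.
binary : ℕ → List Bit
binary n = reverse (bits n)

2-Automatic : {A : Set} → (ℕ → A) → Set
2-Automatic {A} s = ∃ λ (M : DFAO A) → ∀ n → DFAO.run M (binary n) ≡ s n

{-# OPTIONS --safe #-}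
-- Put u = 1/(1 − x) and p = Σ x^(2^j).  Then F = u − 2p, so
-- F⁴ = u⁴ − 8u³p + 24u²p² − 32up³ + 16p⁴.
--
-- Coefficientwise 4up ≤ 3u², hence 32up³ ≤ 24u²p².  The coefficient of xⁿ in
-- u³p is at most that of u³ times the number of powers of 2 up to n, which
-- gives 8u³p < u⁴ for n ≥ 256.  So c(n) > 0 from 256 on, and only finitely
-- many coefficients remain to be computed.
--
-- At n = 2^k − 3 every power of 2 below 2^k is at most n and p⁴ vanishes, so
-- all terms can be summed in closed form: 6c(n) ≡ 16R(k) modulo 2^k for the
-- cubic R(k) = 35 + 51k − 18k² − 12k³.  As R(k + h) − R(k) is h times an odd
-- number, for every t there are arbitrarily large k with R(k) of 2-adic order
-- exactly t (Hensel), and adding an odd multiple of 2^(t+1) to such a k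
-- changes odd(c(n)) modulo 4.  The binary expansion of 2^k − 3 being
-- 1⋯101, an automaton for ω would make ω(2^k − 3) eventually periodic in k,
-- with a period that may be taken to be a difference 2^j − 2^t.
module Submission where

open import Defs
open import Data.Integer.Base using (0ℤ)
open import Data.Product.Base using (_×_)
open import Relation.Binary.PropositionalEquality using (_≢_)
open import Relation.Nullary using (¬_)

open import Algebra.Bundles using (CommutativeSemiring)
import Algebra.Construct.Pointwise as Pointwise
open import Data.Bool.Base using (true; false; if_then_else_)
open import Data.Digit using (Bit; 0b; 1b)
open import Data.Empty using (⊥)
open import Data.Fin.Base using (Fin; zero; suc; toℕ)
open import Data.Fin.Properties using (pigeonhole; toℕ-fromℕ<)
open import Data.Integer.Base as ℤ using
  (ℤ; +_; -[1+_]; 1ℤ; -1ℤ; _+_; _*_; _-_; _/ℕ_; _%ℕ_; ∣_∣)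
open import Data.Integer.Divisibility using (_∣_)
open import Data.Integer.DivMod using (a≡a%ℕn+[a/ℕn]*n; n%ℕd<d)
open import Data.Integer.Properties as ℤ using ()
open import Data.Integer.Tactic.RingSolver using (solve-∀)
open import Data.List.Base using (List; []; _∷_; map; zipWith; foldr; replicate)
open import Data.List.Properties using (reverse-foldl)
open import Data.List.Relation.Unary.All using (All; []; _∷_; all?)
open import Data.Nat.Base as ℕ using
  (ℕ; zero; suc; _^_; _∸_; _≤_; _<_; z≤n; s≤s; z<s; s<s)
open import Data.Nat.Divisibility using (m∣m*n; n∣m⇒m%n≡0) renaming (_∣_ to _∣ℕ_)
open import Data.Nat.Properties as ℕ using ()
open import Data.Nat.Tactic.RingSolver using () renaming (solve-∀ to ℕ-solve-∀)
open import Data.Product.Base using (∃; ∃₂; _,_; proj₁; proj₂)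
open import Data.Sum.Base using (_⊎_; inj₁; inj₂)
open import Function.Base using (_∘_; _$_; flip)
open import Relation.Binary.PropositionalEquality using
  (_≡_; _≗_; refl; sym; trans; cong; cong₂; subst; subst₂; module ≡-Reasoning)
open import Relation.Nullary using (¬?; does; yes; no; contradiction)
open import Relation.Nullary.Decidable using (from-yes; dec-true; dec-false)
open import Algebra.Structures {A = Series} _≗_ using (IsCommutativeSemiring)
open import Algebra.Structures.Biased {A = Series} _≗_ using (isCommutativeSemiringˡ)

-- The semiring of power series

infixl 6 _⊕_
_⊕_ : Series → Series → Series
(f ⊕ g) n = f n + g n

infixl 7 _·_
_·_ : ℤ → Series → Series
(k · f) n = k * f n

0ˢ : Series
0ˢ _ = 0ℤ

-- Convolution unfolds definitionally: `(f ⊛ g) (suc n)` is `f 0 * g (suc n) + (tail f ⊛ g) n`. The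
-- inductions on the index use this, with the left factor left general.
tail : Series → Series
tail f = f ∘ suc

⊛-cong : ∀ {f f′ g g′} → f ≗ f′ → g ≗ g′ → f ⊛ g ≗ f′ ⊛ g′
⊛-cong f≗ g≗ zero    = cong₂ (λ x y → x * y + 0ℤ) (f≗ 0) (g≗ 0)
⊛-cong f≗ g≗ (suc n) =
  cong₂ _+_ (cong₂ _*_ (f≗ 0) (g≗ (suc n))) (⊛-cong (f≗ ∘ suc) g≗ n)

⊛-zeroˡ : ∀ f → 0ˢ ⊛ f ≗ 0ˢ
⊛-zeroˡ f zero    = refl
⊛-zeroˡ f (suc n) = cong (_+_ 0ℤ) (⊛-zeroˡ f n)

⊛-identityˡ : ∀ f → 1ˢ ⊛ f ≗ f
⊛-identityˡ f zero    = trans (ℤ.+-identityʳ _) (ℤ.*-identityˡ (f 0))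
⊛-identityˡ f (suc n) =
  trans (cong₂ _+_ (ℤ.*-identityˡ (f (suc n))) (⊛-zeroˡ f n)) (ℤ.+-identityʳ _)

⊛-distribʳ : ∀ f g h → (g ⊕ h) ⊛ f ≗ g ⊛ f ⊕ h ⊛ f
⊛-distribʳ f g h zero    = lemma (g 0) (h 0) (f 0)
  where
  lemma : ∀ x y z → (x + y) * z + 0ℤ ≡ x * z + 0ℤ + (y * z + 0ℤ)
  lemma = solve-∀
⊛-distribʳ f g h (suc n) =
  trans (cong (_+_ ((g 0 + h 0) * f (suc n))) (⊛-distribʳ f (tail g) (tail h) n))
        (lemma (g 0) (h 0) (f (suc n)) ((tail g ⊛ f) n) ((tail h ⊛ f) n))
  where
  lemma : ∀ x y z v w → (x + y) * z + (v + w) ≡ (x * z + v) + (y * z + w)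
  lemma = solve-∀

⊛-scale : ∀ k f g n → ((k · f) ⊛ g) n ≡ k * (f ⊛ g) n
⊛-scale k f g zero    = lemma k (f 0) (g 0)
  where
  lemma : ∀ x y z → x * y * z + 0ℤ ≡ x * (y * z + 0ℤ)
  lemma = solve-∀
⊛-scale k f g (suc n) =
  trans (cong (_+_ (k * f 0 * g (suc n))) (⊛-scale k (tail f) g n))
        (lemma k (f 0) (g (suc n)) ((tail f ⊛ g) n))
  where
  lemma : ∀ x y z w → x * y * z + x * w ≡ x * (y * z + w)
  lemma = solve-∀

-- Splits off the last summand instead of the first, the mirror image of the definitional unfolding;
-- commutativity follows by matching the two.
⊛-sucʳ : ∀ f g n → (f ⊛ g) (suc n) ≡ f (suc n) * g 0 + (f ⊛ tail g) n
⊛-sucʳ f g zero    = lemma (f 0) (f 1) (g 0) (g 1)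
  where
  lemma : ∀ x x′ y y′ → x * y′ + (x′ * y + 0ℤ) ≡ x′ * y + (x * y′ + 0ℤ)
  lemma = solve-∀
⊛-sucʳ f g (suc n) =
  trans (cong (_+_ (f 0 * g (suc (suc n)))) (⊛-sucʳ (tail f) g n))
        (lemma (f 0 * g (suc (suc n))) (f (suc (suc n)) * g 0) _)
  where
  lemma : ∀ x y z → x + (y + z) ≡ y + (x + z)
  lemma = solve-∀

⊛-comm : ∀ f g → f ⊛ g ≗ g ⊛ f
⊛-comm f g zero    = cong (_+ 0ℤ) (ℤ.*-comm (f 0) (g 0))
⊛-comm f g (suc n) =
  trans (cong₂ _+_ (ℤ.*-comm (f 0) (g (suc n))) (⊛-comm (tail f) g n))
        (sym (⊛-sucʳ g f n))

⊛-assoc : ∀ f g h → (f ⊛ g) ⊛ h ≗ f ⊛ (g ⊛ h)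
⊛-assoc f g h zero    = lemma (f 0) (g 0) (h 0)
  where
  lemma : ∀ x y z → (x * y + 0ℤ) * z + 0ℤ ≡ x * (y * z + 0ℤ) + 0ℤ
  lemma = solve-∀
⊛-assoc f g h (suc n) = begin
  -- `tail (f ⊛ g)` is by definition `f 0 · tail g ⊕ tail f ⊛ g`, so distributivity exposes a
  -- product to which the induction hypothesis applies.
  (f ⊛ g) 0 * h (suc n) + ((f 0 · tail g ⊕ tail f ⊛ g) ⊛ h) n
    ≡⟨ cong (_+_ ((f ⊛ g) 0 * h (suc n))) (⊛-distribʳ h (f 0 · tail g) (tail f ⊛ g) n) ⟩
  (f ⊛ g) 0 * h (suc n) + (((f 0 · tail g) ⊛ h) n + ((tail f ⊛ g) ⊛ h) n)
    ≡⟨ cong₂ (λ x y → (f ⊛ g) 0 * h (suc n) + (x + y))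
             (⊛-scale (f 0) (tail g) h n) (⊛-assoc (tail f) g h n) ⟩
  (f ⊛ g) 0 * h (suc n) + (f 0 * (tail g ⊛ h) n + (tail f ⊛ (g ⊛ h)) n)
    ≡⟨ lemma (f 0) (g 0) (h (suc n)) ((tail g ⊛ h) n) _ ⟩
  (f ⊛ (g ⊛ h)) (suc n) ∎
  where
  open ≡-Reasoning
  lemma : ∀ x y z v w →
          (x * y + 0ℤ) * z + (x * v + w) ≡ x * (y * z + v) + w
  lemma = solve-∀

series-isCommutativeSemiring : IsCommutativeSemiring _⊕_ _⊛_ 0ˢ 1ˢ
series-isCommutativeSemiring = isCommutativeSemiringˡ record
  { +-isCommutativeMonoid = Pointwise.isCommutativeMonoid ℕ ℤ.+-0-isCommutativeMonoid
  ; *-isCommutativeMonoid = record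
    { isMonoid = record
      { isSemigroup = record
        { isMagma = record
          { isEquivalence = record
            { refl = λ _ → refl ; sym = λ p n → sym (p n) ; trans = λ p q n → trans (p n) (q n) }
          ; ∙-cong = ⊛-cong }
        ; assoc = ⊛-assoc }
      ; identity = ⊛-identityˡ , λ f n → trans (⊛-comm f 1ˢ n) (⊛-identityˡ f n) }
    ; comm = ⊛-comm }
  ; distribʳ = ⊛-distribʳ
  ; zeroˡ = ⊛-zeroˡ
  }

series : CommutativeSemiring _ _
series = record { isCommutativeSemiring = series-isCommutativeSemiring }

open import Algebra.Properties.Semiring.Mult (CommutativeSemiring.semiring series)
  using () renaming (_×_ to _×ˢ_)
open import Algebra.Solver.Ring.NaturalCoefficients.Default series
  using (solve; _:=_; _:+_; _:*_; _:×_; con)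

-- The solver expresses numerical coefficients as iterated sums of series; this turns them back into
-- integer factors.
×ˢ-eval : ∀ k f n → (k ×ˢ f) n ≡ + k * f n
×ˢ-eval zero    f n = refl
×ˢ-eval (suc k) f n =
  trans (cong (_+_ (f n)) (×ˢ-eval k f n)) (sym (ℤ.suc-* (+ k) (f n)))

-- f⁴ = (v − 2p)⁴ with the negative terms moved to the left, a semiring identity.
fourth-power : ∀ f p → let v = f ⊕ (p ⊕ p) in
  f ^ˢ 4 ⊕ (8 ×ˢ (p ⊛ (v ⊛ (v ⊛ v))) ⊕ 32 ×ˢ (p ⊛ (p ⊛ (p ⊛ v))))
  ≗ v ⊛ (v ⊛ (v ⊛ v)) ⊕ (24 ×ˢ (p ⊛ (p ⊛ (v ⊛ v))) ⊕ 16 ×ˢ (p ⊛ (p ⊛ (p ⊛ p))))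
fourth-power = solve 2 (λ f p → let v = f :+ (p :+ p) in
  f :* (f :* (f :* (f :* con 1)))
    :+ (8 :× (p :* (v :* (v :* v))) :+ 32 :× (p :* (p :* (p :* v))))
  := v :* (v :* (v :* v))
    :+ (24 :× (p :* (p :* (v :* v))) :+ 16 :× (p :* (p :* (p :* p)))))
  (λ _ → refl)

-- Multiplication by p

IsPowerOf2 : ℕ → Set
IsPowerOf2 n = ∃ λ j → n ≡ 2 ^ j

u p : Series
u _ = 1ℤ
p n = if does (powerOf2? n) then 1ℤ else 0ℤ

a+2p≗u : a ⊕ (p ⊕ p) ≗ u
a+2p≗u n with does (powerOf2? n)
... | true  = refl
... | false = refl

p-powerOf2 : ∀ {n} → IsPowerOf2 n → p n ≡ 1ℤ
p-powerOf2 {n} n≡2^ = cong (if_then 1ℤ else 0ℤ) (dec-true (powerOf2? n) n≡2^)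

p-¬powerOf2 : ∀ {n} → ¬ IsPowerOf2 n → p n ≡ 0ℤ
p-¬powerOf2 {n} n≢2^ = cong (if_then 1ℤ else 0ℤ) (dec-false (powerOf2? n) n≢2^)

-- Finite sums and monomials

∑< : ℕ → (ℕ → ℤ) → ℤ
∑< zero    f = 0ℤ
∑< (suc k) f = ∑< k f + f k

∑<-cong : ∀ k {f g} → (∀ {j} → j < k → f j ≡ g j) → ∑< k f ≡ ∑< k g
∑<-cong zero    f≡g = refl
∑<-cong (suc k) f≡g = cong₂ _+_ (∑<-cong k (f≡g ∘ ℕ.m<n⇒m<1+n)) (f≡g ℕ.≤-refl)

∑<-const : ∀ k z → ∑< k (λ _ → z) ≡ + k * z
∑<-const zero    z = refl
∑<-const (suc k) z =
  trans (cong (_+ z) (∑<-const k z)) (trans (ℤ.+-comm (+ k * z) z) (sym (ℤ.suc-* (+ k) z)))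

∑<-≤ : ∀ k {f z} → (∀ {j} → j < k → f j ℤ.≤ z) → ∑< k f ℤ.≤ + k * z
∑<-≤ k {f} {z} f≤ = subst (∑< k f ℤ.≤_) (∑<-const k z) (go k f≤)
  where
  go : ∀ k {f z} → (∀ {j} → j < k → f j ℤ.≤ z) → ∑< k f ℤ.≤ ∑< k (λ _ → z)
  go zero    f≤ = ℤ.≤-refl
  go (suc k) f≤ = ℤ.+-mono-≤ (go k (f≤ ∘ ℕ.m<n⇒m<1+n)) (f≤ ℕ.≤-refl)

⊛-congˡ-≤ : ∀ {f f′} g n → (∀ {i} → i ≤ n → f i ≡ f′ i) → (f ⊛ g) n ≡ (f′ ⊛ g) n
⊛-congˡ-≤ g zero    f≡ = cong (λ x → x * g 0 + 0ℤ) (f≡ z≤n)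
⊛-congˡ-≤ g (suc n) f≡ =
  cong₂ _+_ (cong (_* g (suc n)) (f≡ z≤n)) (⊛-congˡ-≤ g n (f≡ ∘ s≤s))

∑<-⊛ : ∀ k (f : ℕ → Series) g n →
       ((λ i → ∑< k (λ j → f j i)) ⊛ g) n ≡ ∑< k (λ j → (f j ⊛ g) n)
∑<-⊛ zero    f g n = ⊛-zeroˡ g n
∑<-⊛ (suc k) f g n =
  trans (⊛-distribʳ g (λ i → ∑< k (λ j → f j i)) (f k) n)
        (cong (_+ (f k ⊛ g) n) (∑<-⊛ k f g n))

monomial : ℕ → Series
monomial zero            = 1ˢ
monomial (suc d) zero    = 0ℤ
monomial (suc d) (suc n) = monomial d n

monomial-diag : ∀ d → monomial d d ≡ 1ℤ
monomial-diag zero    = refl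
monomial-diag (suc d) = monomial-diag d

monomial-≢ : ∀ {d n} → n ≢ d → monomial d n ≡ 0ℤ
monomial-≢ {zero}  {zero}  n≢d = contradiction refl n≢d
monomial-≢ {zero}  {suc n} n≢d = refl
monomial-≢ {suc d} {zero}  n≢d = refl
monomial-≢ {suc d} {suc n} n≢d = monomial-≢ (n≢d ∘ cong suc)

monomial-⊛ : ∀ {d n} → d ≤ n → ∀ g → (monomial d ⊛ g) n ≡ g (n ∸ d)
monomial-⊛ z≤n       g = ⊛-identityˡ g _
monomial-⊛ (s≤s d≤n) g = trans (ℤ.+-identityˡ _) (monomial-⊛ d≤n g)

∑<-zero : ∀ k {f} → (∀ {j} → j < k → f j ≡ 0ℤ) → ∑< k f ≡ 0ℤ
∑<-zero k f≡0 = trans (∑<-cong k f≡0) (trans (∑<-const k 0ℤ) (ℤ.*-zeroʳ (+ k)))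

2^-mono-≤ : ∀ {i j} → i ≤ j → 2 ^ i ≤ 2 ^ j
2^-mono-≤ = ℕ.^-monoʳ-≤ 2

2^-mono-< : ∀ {i j} → i < j → 2 ^ i < 2 ^ j
2^-mono-< = ℕ.^-monoʳ-< 2 (s<s z<s)

2^-cancel-< : ∀ {i j} → 2 ^ i < 2 ^ j → i < j
2^-cancel-< {i} {j} 2^i<2^j = ℕ.≰⇒> λ j≤i → ℕ.<⇒≱ 2^i<2^j (2^-mono-≤ j≤i)

-- Below 2^k the infinite sum p agrees with its first k terms, which makes multiplication by p a
-- finite sum of shifts.
p-monomials : ∀ k {n} → n < 2 ^ k → p n ≡ ∑< k (λ j → monomial (2 ^ j) n)
p-monomials k {n} n<2^k with powerOf2? n
... | no  n≢2^ = trans (p-¬powerOf2 n≢2^) $ sym $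
  ∑<-zero k λ {j} _ → monomial-≢ λ n≡2^j → n≢2^ (j , n≡2^j)
... | yes (i , refl) = trans (p-powerOf2 (i , refl)) $ sym (go k (2^-cancel-< n<2^k))
  where
  go : ∀ k → i < k → ∑< k (λ j → monomial (2 ^ j) (2 ^ i)) ≡ 1ℤ
  go (suc k) i<1+k with ℕ.m<1+n⇒m<n∨m≡n i<1+k
  ... | inj₁ i<k  = cong₂ _+_ (go k i<k) (monomial-≢ (ℕ.<⇒≢ (2^-mono-< i<k)))
  ... | inj₂ refl = cong₂ _+_
    (∑<-zero k λ j<k → monomial-≢ (ℕ.>⇒≢ (2^-mono-< j<k))) (monomial-diag (2 ^ k))

p⊛-eval : ∀ k {n} → 2 ^ k ≤ n → n < 2 ^ suc k → ∀ g →
          (p ⊛ g) n ≡ ∑< (suc k) (λ j → g (n ∸ 2 ^ j))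
p⊛-eval k {n} 2^k≤n n<2^1+k g =
  trans (⊛-congˡ-≤ g n λ i≤n → p-monomials (suc k) (ℕ.≤-<-trans i≤n n<2^1+k))
        (trans (∑<-⊛ (suc k) (λ j → monomial (2 ^ j)) g n)
               (∑<-cong (suc k) λ j<1+k →
                 monomial-⊛ (ℕ.≤-trans (2^-mono-≤ (ℕ.s≤s⁻¹ j<1+k)) 2^k≤n) g))

log₂-bracket : ∀ n → ∃ λ k → 2 ^ k ≤ suc n × suc n < 2 ^ suc k
log₂-bracket zero    = 0 , s≤s z≤n , s<s z<s
log₂-bracket (suc n) with log₂-bracket n
... | k , lo , hi with ℕ.m≤n⇒m<n∨m≡n hi
...   | inj₁ lt = k , ℕ.m≤n⇒m≤1+n lo , lt
...   | inj₂ eq = suc k , ℕ.≤-reflexive (sym eq) ,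
                  subst (_< 2 ^ suc (suc k)) (sym eq) (2^-mono-< {suc k} ℕ.≤-refl)

-- Powers of 1/(1 - x) and the expansion of F⁴

uu uuu uuuu : Series
uu   = u ⊛ u
uuu  = u ⊛ uu
uuuu = u ⊛ uuu

uu-eval : ∀ n → uu n ≡ 1ℤ + + n
uu-eval zero    = refl
uu-eval (suc n) = cong (λ x → 1ℤ + x) (uu-eval n)

-- Multiplying by u forms partial sums, so the coefficients are binomial: n + 2 over 2 here, n + 3
-- over 3 for `uuuu`. The factors 2 and 6 clear the denominators.
uuu-eval : ∀ n → + 2 * uuu n ≡ (+ 1 + + n) * (+ 2 + + n)
uuu-eval zero    = refl
uuu-eval (suc n) =
  trans (ℤ.*-distribˡ-+ (+ 2) (1ℤ * uu (suc n)) (uuu n))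
        (trans (cong₂ (λ x y → + 2 * (1ℤ * x) + y) (uu-eval (suc n)) (uuu-eval n)) (lemma (+ n)))
  where
  lemma : ∀ m → + 2 * (1ℤ * (1ℤ + (1ℤ + m))) + (+ 1 + m) * (+ 2 + m)
                ≡ (+ 1 + (1ℤ + m)) * (+ 2 + (1ℤ + m))
  lemma = solve-∀

uuuu-eval : ∀ n → + 6 * uuuu n ≡ (+ 1 + + n) * (+ 2 + + n) * (+ 3 + + n)
uuuu-eval zero    = refl
uuuu-eval (suc n) =
  trans (lemma₁ (uuu (suc n)) (uuuu n))
        (trans (cong₂ (λ x y → + 3 * x + y) (uuu-eval (suc n)) (uuuu-eval n)) (lemma₂ (+ n)))
  where
  lemma₁ : ∀ x y → + 6 * (1ℤ * x + y) ≡ + 3 * (+ 2 * x) + + 6 * y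
  lemma₁ = solve-∀
  lemma₂ : ∀ m → + 3 * ((+ 1 + (1ℤ + m)) * (+ 2 + (1ℤ + m))) + (+ 1 + m) * (+ 2 + m) * (+ 3 + m)
                 ≡ (+ 1 + (1ℤ + m)) * (+ 2 + (1ℤ + m)) * (+ 3 + (1ℤ + m))
  lemma₂ = solve-∀

-- `fourth-power` at a and p. There v is only pointwise equal to u, so the equality is carried
-- through every product by congruence.
c-expansion : ∀ n →
  c n + (+ 8 * (p ⊛ uuu) n + + 32 * (p ⊛ (p ⊛ (p ⊛ u))) n)
  ≡ uuuu n + (+ 24 * (p ⊛ (p ⊛ uu)) n + + 16 * (p ⊛ (p ⊛ (p ⊛ p))) n)
c-expansion n = trans (sym lhs) (trans (fourth-power a p n) rhs)
  where
  v = a ⊕ (p ⊕ p)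
  p⊛-cong : ∀ f g → f ≗ g → p ⊛ f ≗ p ⊛ g
  p⊛-cong f g = ⊛-cong {p} {p} {f} {g} λ _ → refl
  v⊛-cong : ∀ f g → f ≗ g → v ⊛ f ≗ u ⊛ g
  v⊛-cong f g = ⊛-cong {v} {u} {f} {g} a+2p≗u
  v² : v ⊛ v ≗ uu
  v² = v⊛-cong v u a+2p≗u
  v³ : v ⊛ (v ⊛ v) ≗ uuu
  v³ = v⊛-cong (v ⊛ v) uu v²
  scaled : ∀ k f g → f ≗ g → (k ×ˢ f) n ≡ + k * g n
  scaled k f g f≗g = trans (×ˢ-eval k f n) (cong (+ k *_) (f≗g n))
  lhs = cong (_+_ (c n)) (cong₂ _+_
    (scaled 8 (p ⊛ (v ⊛ (v ⊛ v))) (p ⊛ uuu) (p⊛-cong (v ⊛ (v ⊛ v)) uuu v³))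
    (scaled 32 (p ⊛ (p ⊛ (p ⊛ v))) (p ⊛ (p ⊛ (p ⊛ u)))
      (p⊛-cong (p ⊛ (p ⊛ v)) (p ⊛ (p ⊛ u)) (p⊛-cong (p ⊛ v) (p ⊛ u) (p⊛-cong v u a+2p≗u)))))
  rhs = cong₂ _+_ (v⊛-cong (v ⊛ (v ⊛ v)) uuu v³ n) (cong₂ _+_
    (scaled 24 (p ⊛ (p ⊛ (v ⊛ v))) (p ⊛ (p ⊛ uu))
      (p⊛-cong (p ⊛ (v ⊛ v)) (p ⊛ uu) (p⊛-cong (v ⊛ v) uu v²)))
    (scaled 16 (p ⊛ (p ⊛ (p ⊛ p))) (p ⊛ (p ⊛ (p ⊛ p))) λ _ → refl))

-- Non-vanishing

prefix : ℕ → Series → List ℤ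
prefix zero    f = []
prefix (suc n) f = f 0 ∷ prefix n (tail f)

-- The Cauchy product truncated to the length of the left factor. On lists the coefficients of an
-- inner product are shared rather than recomputed for each coefficient of the outer one.
_⊛ᴸ_ : List ℤ → List ℤ → List ℤ
(x ∷ xs) ⊛ᴸ (y ∷ ys) = x * y ∷ zipWith _+_ (map (x *_) ys) (xs ⊛ᴸ (y ∷ ys))
_        ⊛ᴸ _        = []

prefix-zipWith : ∀ {m n} x f g → m ≤ n →
  zipWith _+_ (map (x *_) (prefix n f)) (prefix m g) ≡ prefix m (x · f ⊕ g)
prefix-zipWith {n = zero}  x f g z≤n = refl
prefix-zipWith {n = suc _} x f g z≤n = refl
prefix-zipWith x f g (s≤s m≤n) =
  cong (x * f 0 + g 0 ∷_) (prefix-zipWith x (tail f) (tail g) m≤n)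

-- Two lengths are needed because the recursion shortens the left factor only.
prefix-⊛ : ∀ {m n} f g → m ≤ n → prefix m f ⊛ᴸ prefix n g ≡ prefix m (f ⊛ g)
prefix-⊛ f g z≤n = refl
prefix-⊛ f g (s≤s {m} {n} m≤n) = cong₂ _∷_ (sym (ℤ.+-identityʳ (f 0 * g 0)))
  (trans (cong (zipWith _+_ (map (f 0 *_) (prefix n (tail g))))
               (prefix-⊛ (tail f) g (ℕ.m≤n⇒m≤1+n m≤n)))
         (prefix-zipWith (f 0) (tail g) (tail f ⊛ g) m≤n))

prefix-All : ∀ {P : ℤ → Set} n f → All P (prefix n f) → ∀ {i} → i < n → P (f i)
prefix-All (suc n) f (p ∷ ps) {zero}  _         = p
prefix-All (suc n) f (p ∷ ps) {suc i} (s≤s i<n) = prefix-All n (tail f) ps i<n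

prefix-cong : ∀ n {f g} → (∀ {i} → i < n → f i ≡ g i) → prefix n f ≡ prefix n g
prefix-cong zero    f≡g = refl
prefix-cong (suc n) f≡g = cong₂ _∷_ (f≡g z<s) (prefix-cong n (f≡g ∘ s<s))

prefix-^ : ∀ n f {fs} → prefix n f ≡ fs →
  prefix n (f ^ˢ 4) ≡ fs ⊛ᴸ (fs ⊛ᴸ (fs ⊛ᴸ (fs ⊛ᴸ prefix n 1ˢ)))
prefix-^ n f refl = sym
  (trans (cong (λ xs → fs ⊛ᴸ (fs ⊛ᴸ (fs ⊛ᴸ xs))) (prefix-⊛ f 1ˢ ℕ.≤-refl))
  (trans (cong (λ xs → fs ⊛ᴸ (fs ⊛ᴸ xs)) (prefix-⊛ f (f ^ˢ 1) ℕ.≤-refl))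
  (trans (cong (fs ⊛ᴸ_) (prefix-⊛ f (f ^ˢ 2) ℕ.≤-refl)) (prefix-⊛ f (f ^ˢ 3) ℕ.≤-refl))))
  where fs = prefix n f

a-monomials : ∀ k {n} → n < 2 ^ k → a n ≡ 1ℤ - + 2 * ∑< k (λ j → monomial (2 ^ j) n)
a-monomials k {n} n<2^k =
  trans (lemma (a n) (p n)) (cong₂ (λ x y → x - + 2 * y) (a+2p≗u n) (p-monomials k n<2^k))
  where
  lemma : ∀ x y → x ≡ x + (y + y) - + 2 * y
  lemma = solve-∀

-- The decision procedure powerOf2? is too slow to compute these entries of a.
a-prefix : ℕ → List ℤ
a-prefix k = prefix (2 ^ k) (λ n → 1ℤ - + 2 * ∑< k (λ j → monomial (2 ^ j) n))

c-prefix : ℕ → List ℤ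
c-prefix k = as ⊛ᴸ (as ⊛ᴸ (as ⊛ᴸ (as ⊛ᴸ prefix (2 ^ k) 1ˢ)))
  where as = a-prefix k

c-prefix-All : ∀ {P : ℤ → Set} k → All P (c-prefix k) → ∀ {n} → n < 2 ^ k → P (c n)
c-prefix-All {P} k all = prefix-All (2 ^ k) c
  (subst (All P) (sym (prefix-^ (2 ^ k) a (prefix-cong (2 ^ k) (a-monomials k)))) all)

-- Positivity cannot be the argument for all n, since c(1) = -4. The first 256 coefficients are
-- computed, up to the threshold of `8puuu<uuuu`.
c≢0-small : ∀ {n} → n < 2 ^ 8 → c n ≢ 0ℤ
c≢0-small = c-prefix-All {_≢ 0ℤ} 8 (from-yes (all? (λ z → ¬? (z ℤ.≟ 0ℤ)) (c-prefix 8)))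

-- Positivity of c from 256 on

NonNeg : Series → Set
NonNeg f = ∀ n → 0ℤ ℤ.≤ f n

p-nonNeg : NonNeg p
p-nonNeg n with does (powerOf2? n)
... | true  = ℤ.+≤+ z≤n
... | false = ℤ.+≤+ z≤n

*-monoˡ-≤-nonNeg : ∀ {x y z} → 0ℤ ℤ.≤ x → y ℤ.≤ z → x * y ℤ.≤ x * z
*-monoˡ-≤-nonNeg {x} 0≤x y≤z = ℤ.*-monoˡ-≤-nonNeg x {{ℤ.nonNegative 0≤x}} y≤z

⊛-monoʳ-≤ : ∀ f {g h} → NonNeg f → (∀ n → g n ℤ.≤ h n) → ∀ n → (f ⊛ g) n ℤ.≤ (f ⊛ h) n
⊛-monoʳ-≤ f 0≤f g≤h zero    = ℤ.+-monoˡ-≤ 0ℤ (*-monoˡ-≤-nonNeg (0≤f 0) (g≤h 0))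
⊛-monoʳ-≤ f 0≤f g≤h (suc n) = ℤ.+-mono-≤ (*-monoˡ-≤-nonNeg (0≤f 0) (g≤h (suc n)))
                                         (⊛-monoʳ-≤ (tail f) (0≤f ∘ suc) g≤h n)

⊛-zeroʳ : ∀ f → f ⊛ 0ˢ ≗ 0ˢ
⊛-zeroʳ f n = trans (⊛-comm f 0ˢ n) (⊛-zeroˡ f n)

⊛-nonNeg : ∀ f g → NonNeg f → NonNeg g → NonNeg (f ⊛ g)
⊛-nonNeg f g 0≤f 0≤g n = subst (ℤ._≤ (f ⊛ g) n) (⊛-zeroʳ f n) (⊛-monoʳ-≤ f 0≤f 0≤g n)

⊛-scaleʳ : ∀ k f g n → (f ⊛ (k · g)) n ≡ k * (f ⊛ g) n
⊛-scaleʳ k f g n = trans (⊛-comm f (k · g) n)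
  (trans (⊛-scale k g f n) (cong (k *_) (⊛-comm g f n)))

pu-bracket : ∀ k {n} → 2 ^ k ≤ n → n < 2 ^ suc k → (p ⊛ u) n ≡ + suc k
pu-bracket k lo hi = trans (p⊛-eval k lo hi u) (trans (∑<-const (suc k) 1ℤ) (ℤ.*-identityʳ _))

-- This is 4up ≤ 3u² at n = 2^k. It decides the whole range up to 2^(k+1), where up stays equal to k
-- + 1 while u² grows.
4[1+k]≤3[1+2^k] : ∀ k → 4 ℕ.* suc k ≤ 3 ℕ.* suc (2 ^ k)
4[1+k]≤3[1+2^k] zero          = from-yes (4 ℕ.≤? 6)
-- From 0 to 1 the left side gains 4 and the right side only 3, so the induction starts at 1.
4[1+k]≤3[1+2^k] (suc zero)    = from-yes (8 ℕ.≤? 9)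
4[1+k]≤3[1+2^k] (suc (suc k)) = begin
  4 ℕ.* suc (suc (suc k))                  ≡⟨ ℕ.*-suc 4 (suc (suc k)) ⟩
  4 ℕ.+ 4 ℕ.* suc (suc k)                  ≤⟨ ℕ.+-mono-≤ 4≤ (4[1+k]≤3[1+2^k] (suc k)) ⟩
  3 ℕ.* 2 ^ suc k ℕ.+ 3 ℕ.* suc (2 ^ suc k) ≡⟨ lemma (2 ^ suc k) ⟩
  3 ℕ.* suc (2 ^ suc (suc k))              ∎
  where
  open ℕ.≤-Reasoning
  4≤ : 4 ≤ 3 ℕ.* 2 ^ suc k
  4≤ = ℕ.≤-trans (from-yes (4 ℕ.≤? 6)) (ℕ.*-monoʳ-≤ 3 (2^-mono-≤ (s≤s (z≤n {k}))))
  lemma : ∀ x → 3 ℕ.* x ℕ.+ 3 ℕ.* suc x ≡ 3 ℕ.* suc (2 ℕ.* x)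
  lemma = ℕ-solve-∀

4pu≤3uu : ∀ n → (+ 4 · (p ⊛ u)) n ℤ.≤ (+ 3 · uu) n
4pu≤3uu zero    = ℤ.+≤+ z≤n
4pu≤3uu (suc n) with log₂-bracket n
... | k , lo , hi = begin
  + 4 * (p ⊛ u) (suc n)        ≡⟨ cong (+ 4 *_) (pu-bracket k lo hi) ⟩
  + 4 * + suc k                ≡⟨ ℤ.pos-* 4 (suc k) ⟨
  + (4 ℕ.* suc k)              ≤⟨ ℤ.+≤+ (4[1+k]≤3[1+2^k] k) ⟩
  + (3 ℕ.* suc (2 ^ k))        ≤⟨ ℤ.+≤+ (ℕ.*-monoʳ-≤ 3 (s≤s lo)) ⟩
  + (3 ℕ.* suc (suc n))        ≡⟨ ℤ.pos-* 3 (suc (suc n)) ⟩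
  + 3 * + suc (suc n)          ≡⟨ cong (+ 3 *_) (uu-eval (suc n)) ⟨
  + 3 * uu (suc n)             ∎
  where open ℤ.≤-Reasoning

4pppu≤3ppuu : ∀ n → + 4 * (p ⊛ (p ⊛ (p ⊛ u))) n ℤ.≤ + 3 * (p ⊛ (p ⊛ uu)) n
4pppu≤3ppuu n = subst₂ ℤ._≤_ (pp-scale (+ 4) (p ⊛ u)) (pp-scale (+ 3) uu)
  (⊛-monoʳ-≤ p p-nonNeg (⊛-monoʳ-≤ p p-nonNeg 4pu≤3uu) n)
  where
  pp-scale : ∀ k f → (p ⊛ (p ⊛ (k · f))) n ≡ k * (p ⊛ (p ⊛ f)) n
  pp-scale k f = trans (⊛-cong {p} {p} {p ⊛ (k · f)} {k · (p ⊛ f)} (λ _ → refl) (⊛-scaleʳ k p f) n)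
                       (⊛-scaleʳ k p (p ⊛ f) n)

u-nonNeg : NonNeg u
u-nonNeg _ = ℤ.+≤+ z≤n

-- The coefficients of `u ⊛ f` are the partial sums of those of f.
u⊛-mono-≤ : ∀ f → NonNeg f → ∀ {m n} → m ≤ n → (u ⊛ f) m ℤ.≤ (u ⊛ f) n
u⊛-mono-≤ f 0≤f = go ∘ ℕ.≤⇒≤′
  where
  go : ∀ {m n} → m ℕ.≤′ n → (u ⊛ f) m ℤ.≤ (u ⊛ f) n
  go ℕ.≤′-refl           = ℤ.≤-refl
  go {m} (ℕ.≤′-step {n} m≤n) = ℤ.≤-trans (go m≤n)
    (subst (ℤ._≤ (u ⊛ f) (suc n)) (ℤ.+-identityˡ _)
      (ℤ.+-monoˡ-≤ ((u ⊛ f) n) (subst (0ℤ ℤ.≤_) (sym (ℤ.*-identityˡ _)) (0≤f (suc n)))))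

-- The exponent 8 is where this begins to hold: 216 ≤ 256, whereas 7 would ask for 192 ≤ 128. Hence
-- the threshold 256 for n.
24[1+k]≤2^k : ∀ j → 24 ℕ.* suc (j ℕ.+ 8) ≤ 2 ^ (j ℕ.+ 8)
24[1+k]≤2^k zero    = from-yes (216 ℕ.≤? 256)
24[1+k]≤2^k (suc j) = begin
  24 ℕ.* suc (suc (j ℕ.+ 8))              ≤⟨ ℕ.m≤m+n _ _ ⟩
  24 ℕ.* suc (suc (j ℕ.+ 8)) ℕ.+ 24 ℕ.* (j ℕ.+ 8) ≡⟨ lemma (j ℕ.+ 8) ⟩
  2 ℕ.* (24 ℕ.* suc (j ℕ.+ 8))            ≤⟨ ℕ.*-monoʳ-≤ 2 (24[1+k]≤2^k j) ⟩
  2 ^ suc (j ℕ.+ 8)                        ∎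
  where
  open ℕ.≤-Reasoning
  lemma : ∀ x → 24 ℕ.* suc (suc x) ℕ.+ 24 ℕ.* x ≡ 2 ℕ.* (24 ℕ.* suc x)
  lemma = ℕ-solve-∀

-- For 2^k ≤ n < 2^(k+1), `p ⊛ uuu` is a sum of k + 1 shifts of `uuu`, each at most `uuu n`. By the
-- closed forms of `uuu` and `uuuu`, six times the claim reduces to 24(k + 1) < n + 3.
8puuu<uuuu : ∀ {n} → 2 ^ 8 ≤ n → + 8 * (p ⊛ uuu) n ℤ.< uuuu n
8puuu<uuuu {suc m} 256≤n with log₂-bracket m
... | k , lo , hi = ℤ.*-cancelˡ-<-nonNeg (+ 6) $ begin-strict
  + 6 * (+ 8 * (p ⊛ uuu) n)                  ≡⟨ ℤ.*-assoc (+ 6) (+ 8) _ ⟨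
  + 48 * (p ⊛ uuu) n                         ≤⟨ ℤ.*-monoˡ-≤-nonNeg (+ 48) puuu≤ ⟩
  + 48 * (+ suc k * uuu n)                   ≡⟨ lemma (+ suc k) (uuu n) ⟩
  + 24 * + suc k * (+ 2 * uuu n)             ≡⟨ cong₂ _*_ (sym (ℤ.pos-* 24 (suc k))) (uuu-eval n) ⟩
  + (24 ℕ.* suc k) * + N                     <⟨ ℤ.*-monoʳ-<-pos (+ N) (ℤ.+<+ 24[1+k]<3+n) ⟩
  + (3 ℕ.+ n) * + N                          ≡⟨ ℤ.*-comm (+ (3 ℕ.+ n)) (+ N) ⟩
  (+ 1 + + n) * (+ 2 + + n) * (+ 3 + + n)    ≡⟨ uuuu-eval n ⟨
  + 6 * uuuu n                               ∎
  where
  n = suc m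
  N = suc n ℕ.* suc (suc n)
  open ℤ.≤-Reasoning
  lemma : ∀ x y → + 48 * (x * y) ≡ + 24 * x * (+ 2 * y)
  lemma = solve-∀
  8≤k : 8 ≤ k
  8≤k = ℕ.s≤s⁻¹ (2^-cancel-< (ℕ.≤-<-trans 256≤n hi))
  24[1+k]<3+n : 24 ℕ.* suc k < 3 ℕ.+ n
  24[1+k]<3+n = ℕ.≤-<-trans
    (ℕ.≤-trans (subst (λ k → 24 ℕ.* suc k ≤ 2 ^ k) (ℕ.m∸n+n≡m 8≤k) (24[1+k]≤2^k (k ∸ 8))) lo)
    (ℕ.m≤n+m (suc n) 2)
  puuu≤ : (p ⊛ uuu) n ℤ.≤ + suc k * uuu n
  puuu≤ = subst (ℤ._≤ + suc k * uuu n) (sym (p⊛-eval k lo hi uuu))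
    (∑<-≤ (suc k) λ {j} _ → u⊛-mono-≤ uu (⊛-nonNeg u u u-nonNeg u-nonNeg) (ℕ.m∸n≤m n (2 ^ j)))

-- If c(n) were 0, `c-expansion` would equate the terms 8u³p + 32up³ with u⁴ + 24u²p² + 16p⁴, but
-- the former are strictly smaller.
c≢0-large : ∀ {n} → 2 ^ 8 ≤ n → c n ≢ 0ℤ
c≢0-large {n} 256≤n cn≡0 = ℤ.<-irrefl lhs≡ $ begin-strict
  lhs
    <⟨ ℤ.+-mono-<-≤ (8puuu<uuuu 256≤n) 32pppu≤24ppuu ⟩
  uuuu n + + 24 * (p ⊛ (p ⊛ uu)) n
    ≡⟨ cong (_+_ (uuuu n)) (ℤ.+-identityʳ _) ⟨
  uuuu n + (+ 24 * (p ⊛ (p ⊛ uu)) n + 0ℤ)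
    ≤⟨ ℤ.+-monoʳ-≤ (uuuu n) (ℤ.+-monoʳ-≤ (+ 24 * (p ⊛ (p ⊛ uu)) n)
         (*-monoˡ-≤-nonNeg {+ 16} {0ℤ} (ℤ.+≤+ z≤n) pppp-nonNeg)) ⟩
  uuuu n + (+ 24 * (p ⊛ (p ⊛ uu)) n + + 16 * (p ⊛ (p ⊛ (p ⊛ p))) n) ∎
  where
  open ℤ.≤-Reasoning
  lhs = + 8 * (p ⊛ uuu) n + + 32 * (p ⊛ (p ⊛ (p ⊛ u))) n
  lhs≡ : lhs ≡ uuuu n + (+ 24 * (p ⊛ (p ⊛ uu)) n + + 16 * (p ⊛ (p ⊛ (p ⊛ p))) n)
  lhs≡ = trans (sym (ℤ.+-identityˡ lhs)) (trans (cong (_+ lhs) (sym cn≡0)) (c-expansion n))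
  pppp-nonNeg : 0ℤ ℤ.≤ (p ⊛ (p ⊛ (p ⊛ p))) n
  pppp-nonNeg = ⊛-nonNeg p (p ⊛ (p ⊛ p)) p-nonNeg
    (⊛-nonNeg p (p ⊛ p) p-nonNeg (⊛-nonNeg p p p-nonNeg p-nonNeg)) n
  32pppu≤24ppuu : + 32 * (p ⊛ (p ⊛ (p ⊛ u))) n ℤ.≤ + 24 * (p ⊛ (p ⊛ uu)) n
  32pppu≤24ppuu = subst₂ ℤ._≤_ (sym (ℤ.*-assoc (+ 8) (+ 4) _)) (sym (ℤ.*-assoc (+ 8) (+ 3) _))
    (ℤ.*-monoˡ-≤-nonNeg (+ 8) (4pppu≤3ppuu n))

c≢0 : ∀ n → c n ≢ 0ℤ
c≢0 n with ℕ.<-≤-connex n (2 ^ 8)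
... | inj₁ n<256 = c≢0-small n<256
... | inj₂ 256≤n = c≢0-large 256≤n

-- The coefficients at 2^k − 3

2^ℤ : ℕ → ℤ
2^ℤ k = + (2 ^ k)

2^ℤ-suc : ∀ k → 2^ℤ (suc k) ≡ + 2 * 2^ℤ k
2^ℤ-suc k = ℤ.pos-* 2 (2 ^ k)

pos-∸ : ∀ {m n} → n ≤ m → + (m ∸ n) ≡ + m - + n
pos-∸ {m} {n} n≤m = trans (sym (ℤ.⊖-≥ n≤m)) (sym (ℤ.m-n≡m⊖n m n))

∑<-linear : ∀ k z t → ∑< k (λ j → z - t * 2^ℤ j) ≡ + k * z - t * (2^ℤ k - 1ℤ)
∑<-linear zero    z t = sym (cong (λ x → 0ℤ - x) (ℤ.*-zeroʳ t))
∑<-linear (suc k) z t = begin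
  ∑< k (λ j → z - t * 2^ℤ j) + (z - t * 2^ℤ k)    ≡⟨ cong (_+ (z - t * 2^ℤ k)) (∑<-linear k z t) ⟩
  + k * z - t * (2^ℤ k - 1ℤ) + (z - t * 2^ℤ k)    ≡⟨ lemma (+ k) z t (2^ℤ k) ⟩
  (1ℤ + + k) * z - t * (+ 2 * 2^ℤ k - 1ℤ)         ≡⟨ cong (λ x → + suc k * z - t * (x - 1ℤ)) (2^ℤ-suc k) ⟨
  + suc k * z - t * (2^ℤ (suc k) - 1ℤ)            ∎
  where
  open ≡-Reasoning
  lemma : ∀ k z t x → k * z - t * (x - 1ℤ) + (z - t * x) ≡ (1ℤ + k) * z - t * (+ 2 * x - 1ℤ)
  lemma = solve-∀

-- The factor 3 clears the denominator of the geometric sum of 4^j.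
∑<-quadratic : ∀ k v w → + 3 * ∑< k (λ j → (v - 2^ℤ j) * (w - 2^ℤ j))
  ≡ + 3 * + k * v * w - + 3 * (v + w) * (2^ℤ k - 1ℤ) + (2^ℤ k * 2^ℤ k - 1ℤ)
∑<-quadratic zero    v w = lemma v w
  where
  lemma : ∀ v w → + 3 * 0ℤ ≡ + 3 * 0ℤ * v * w - + 3 * (v + w) * (1ℤ - 1ℤ) + (1ℤ * 1ℤ - 1ℤ)
  lemma = solve-∀
∑<-quadratic (suc k) v w = begin
  + 3 * (s + t)         ≡⟨ ℤ.*-distribˡ-+ (+ 3) s t ⟩
  + 3 * s + + 3 * t     ≡⟨ cong (_+ + 3 * t) (∑<-quadratic k v w) ⟩
  closed (+ k) (2^ℤ k) + + 3 * t              ≡⟨ lemma (+ k) v w (2^ℤ k) ⟩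
  closed (+ suc k) (+ 2 * 2^ℤ k)              ≡⟨ cong (closed (+ suc k)) (2^ℤ-suc k) ⟨
  closed (+ suc k) (2^ℤ (suc k))              ∎
  where
  open ≡-Reasoning
  s = ∑< k (λ j → (v - 2^ℤ j) * (w - 2^ℤ j))
  t = (v - 2^ℤ k) * (w - 2^ℤ k)
  closed : ℤ → ℤ → ℤ
  closed k x = + 3 * k * v * w - + 3 * (v + w) * (x - 1ℤ) + (x * x - 1ℤ)
  lemma : ∀ k v w x →
    + 3 * k * v * w - + 3 * (v + w) * (x - 1ℤ) + (x * x - 1ℤ) + + 3 * ((v - x) * (w - x))
    ≡ + 3 * (1ℤ + k) * v * w - + 3 * (v + w) * (+ 2 * x - 1ℤ) + ((+ 2 * x) * (+ 2 * x) - 1ℤ)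
  lemma = solve-∀

∑<-distribˡ : ∀ k z f → z * ∑< k f ≡ ∑< k (λ j → z * f j)
∑<-distribˡ zero    z f = ℤ.*-zeroʳ z
∑<-distribˡ (suc k) z f =
  trans (ℤ.*-distribˡ-+ z (∑< k f) (f k)) (cong (_+ z * f k) (∑<-distribˡ k z f))

2^-double : ∀ k → 2 ^ suc k ≡ 2 ^ k ℕ.+ 2 ^ k
2^-double k = cong (2 ^ k ℕ.+_) (ℕ.+-identityʳ (2 ^ k))

-- The numbers 2^(k+1) - s with 1 ≤ s ≤ 2^k are exactly those from 2^k to 2^(k+1) - 1. In this form
-- a multiplication by p just adds 2^j to s, and products can be iterated.
p⊛-below : ∀ k {s} → 1 ≤ s → s ≤ 2 ^ k → ∀ g →
  (p ⊛ g) (2 ^ suc k ∸ s) ≡ ∑< (suc k) (λ j → g (2 ^ suc k ∸ (s ℕ.+ 2 ^ j)))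
p⊛-below k {s} 1≤s s≤2^k g = trans (p⊛-eval k lower upper g)
  (∑<-cong (suc k) λ {j} _ → cong g (ℕ.∸-+-assoc (2 ^ suc k) s (2 ^ j)))
  where
  upper : 2 ^ suc k ∸ s < 2 ^ suc k
  upper = ℕ.∸-monoʳ-< 1≤s (ℕ.≤-trans s≤2^k (ℕ.m≤m+n (2 ^ k) _))
  lower : 2 ^ k ≤ 2 ^ suc k ∸ s
  lower = subst (_≤ 2 ^ suc k ∸ s)
    (trans (cong (_∸ 2 ^ k) (2^-double k)) (ℕ.m+n∸n≡m (2 ^ k) (2 ^ k)))
    (ℕ.∸-monoʳ-≤ (2 ^ suc k) s≤2^k)

-- Subtracting the top power 2^k halves the leading power of the index, which is why the last
-- exponent is split off in the sums below.
2^-∸-cancel : ∀ k s → 2 ^ suc k ∸ (s ℕ.+ 2 ^ k) ≡ 2 ^ k ∸ s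
2^-∸-cancel k s = trans (cong₂ _∸_ (2^-double k) (ℕ.+-comm s (2 ^ k)))
                        (ℕ.[m+n]∸[m+o]≡n∸o (2 ^ k) (2 ^ k) s)

pu-below : ∀ k {s} → 1 ≤ s → s ≤ 2 ^ k → (p ⊛ u) (2 ^ suc k ∸ s) ≡ + suc k
pu-below k 1≤s s≤2^k =
  trans (p⊛-below k 1≤s s≤2^k u) (trans (∑<-const (suc k) 1ℤ) (ℤ.*-identityʳ _))

3≤2^ : ∀ {k} → 2 ≤ k → 3 ≤ 2 ^ k
3≤2^ 2≤k = ℕ.≤-trans (ℕ.n≤1+n 3) (2^-mono-≤ 2≤k)

+2^≤2^ : ∀ {s j k} → s ≤ 2 ^ k → j ≤ k → s ℕ.+ 2 ^ j ≤ 2 ^ suc k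
+2^≤2^ {s} {j} {k} s≤2^k j≤k =
  subst (s ℕ.+ 2 ^ j ≤_) (sym (2^-double k)) (ℕ.+-mono-≤ s≤2^k (2^-mono-≤ j≤k))

3+2^≤2^ : ∀ {j k} → 2 ≤ k → j ≤ k → 3 ℕ.+ 2 ^ j ≤ 2 ^ suc k
3+2^≤2^ 2≤k = +2^≤2^ (3≤2^ 2≤k)

3+2^+2^≤2^ : ∀ {i j k} → 2 ≤ k → i ≤ k → j ≤ suc k →
             3 ℕ.+ 2 ^ i ℕ.+ 2 ^ j ≤ 2 ^ suc (suc k)
3+2^+2^≤2^ 2≤k i≤k = +2^≤2^ (3+2^≤2^ 2≤k i≤k)

1≤3+ : ∀ {n} → 1 ≤ 3 ℕ.+ n
1≤3+ = s≤s z≤n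

module _ {m} (2≤m : 2 ≤ m) where

  private
    k = + m
    pu-const : ∀ l s n → 1 ≤ s → (∀ {i} → i < n → s ℕ.+ 2 ^ i ≤ 2 ^ l) →
               ∑< n (λ i → (p ⊛ u) (2 ^ suc l ∸ (s ℕ.+ 2 ^ i))) ≡ + n * + suc l
    pu-const l s n 1≤s s≤ = trans
      (∑<-cong n λ {i} i<n → pu-below l (ℕ.≤-trans 1≤s (ℕ.m≤m+n s (2 ^ i))) (s≤ i<n))
      (∑<-const n (+ suc l))

  -- The three cases for the first exponent j are j ≤ m, j = m + 1 (`ppu-second`) and j = m + 2
  -- (`ppu-top`). Here all inner exponents but the top one, m + 2, keep the index at least 2^(m+2).
  ppu-generic : ∀ {j} → j ≤ m → (p ⊛ (p ⊛ u)) (2 ^ (3 ℕ.+ m) ∸ (3 ℕ.+ 2 ^ j))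
                ≡ + (2 ℕ.+ m) * + (3 ℕ.+ m) + + (2 ℕ.+ m)
  ppu-generic {j} j≤m = trans
    (p⊛-below (2 ℕ.+ m) 1≤3+ (3+2^≤2^ (ℕ.m≤n⇒m≤1+n 2≤m) (ℕ.m≤n⇒m≤1+n j≤m)) (p ⊛ u))
    (cong₂ _+_ (pu-const (2 ℕ.+ m) (3 ℕ.+ 2 ^ j) (2 ℕ.+ m) 1≤3+ λ i< →
                 3+2^+2^≤2^ 2≤m j≤m (ℕ.s≤s⁻¹ i<))
               (trans (cong (p ⊛ u) (2^-∸-cancel (2 ℕ.+ m) (3 ℕ.+ 2 ^ j)))
                      (pu-below (suc m) 1≤3+ (3+2^≤2^ 2≤m j≤m))))

  ppu-second : (p ⊛ (p ⊛ u)) (2 ^ (3 ℕ.+ m) ∸ (3 ℕ.+ 2 ^ suc m))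
               ≡ + suc m * + (3 ℕ.+ m) + + (2 ℕ.+ m) + + suc m
  ppu-second = trans (p⊛-below (2 ℕ.+ m) 1≤3+ (3+2^≤2^ (ℕ.m≤n⇒m≤1+n 2≤m) ℕ.≤-refl) (p ⊛ u))
    (cong₂ _+_ (cong₂ _+_
      (pu-const (2 ℕ.+ m) (3 ℕ.+ 2 ^ suc m) (suc m) 1≤3+ λ {i} i< →
        subst (_≤ 2 ^ (2 ℕ.+ m)) (cong (3 ℕ.+_) (ℕ.+-comm (2 ^ i) (2 ^ suc m)))
              (3+2^+2^≤2^ 2≤m (ℕ.s≤s⁻¹ i<) ℕ.≤-refl))
      (trans (cong (p ⊛ u) second) (pu-below (suc m) {3} 1≤3+ (3≤2^ (ℕ.m≤n⇒m≤1+n 2≤m)))))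
      (trans (cong (p ⊛ u) top) (pu-below m {3} 1≤3+ (3≤2^ 2≤m))))
    where
    second : 2 ^ (3 ℕ.+ m) ∸ (3 ℕ.+ 2 ^ suc m ℕ.+ 2 ^ suc m) ≡ 2 ^ (2 ℕ.+ m) ∸ 3
    second = trans (cong (λ x → 2 ^ (3 ℕ.+ m) ∸ (3 ℕ.+ x)) (sym (2^-double (suc m))))
                   (2^-∸-cancel (2 ℕ.+ m) 3)
    top : 2 ^ (3 ℕ.+ m) ∸ (3 ℕ.+ 2 ^ suc m ℕ.+ 2 ^ (2 ℕ.+ m)) ≡ 2 ^ suc m ∸ 3
    top = trans (2^-∸-cancel (2 ℕ.+ m) (3 ℕ.+ 2 ^ suc m)) (2^-∸-cancel (suc m) 3)

  ppu-top : (p ⊛ (p ⊛ u)) (2 ^ (2 ℕ.+ m) ∸ 3) ≡ + suc m * + (2 ℕ.+ m) + + suc m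
  ppu-top = trans (p⊛-below (suc m) 1≤3+ (3≤2^ (ℕ.m≤n⇒m≤1+n 2≤m)) (p ⊛ u))
    (cong₂ _+_ (pu-const (suc m) 3 (suc m) 1≤3+ λ i< → 3+2^≤2^ 2≤m (ℕ.s≤s⁻¹ i<))
               (trans (cong (p ⊛ u) (2^-∸-cancel (suc m) 3))
                      (pu-below m {3} 1≤3+ (3≤2^ 2≤m))))

  -- With K = m + 3 this counts the ordered triples of exponents below K whose powers sum to at most
  -- 2^K - 3. The 3K + 1 excluded triples are those containing K - 1 twice and the orderings of K -
  -- 1, K - 2, K - 2.
  pppu-eval : (p ⊛ (p ⊛ (p ⊛ u))) (2 ^ (3 ℕ.+ m) ∸ 3)
              ≡ (k + + 3) * (k + + 3) * (k + + 3) - + 3 * (k + + 3) - 1ℤ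
  pppu-eval = begin
    (p ⊛ (p ⊛ (p ⊛ u))) (2 ^ (3 ℕ.+ m) ∸ 3)
      ≡⟨ p⊛-below (2 ℕ.+ m) 1≤3+ (3≤2^ (ℕ.m≤n⇒m≤1+n (ℕ.m≤n⇒m≤1+n 2≤m))) (p ⊛ (p ⊛ u)) ⟩
    _ ≡⟨ cong₂ _+_ (cong₂ _+_
           (trans (∑<-cong (suc m) λ j< → ppu-generic (ℕ.s≤s⁻¹ j<)) (∑<-const (suc m) _))
           ppu-second)
           (trans (cong (p ⊛ (p ⊛ u)) (2^-∸-cancel (2 ℕ.+ m) 3)) ppu-top) ⟩
    _ ≡⟨ lemma k ⟩
    _ ∎
    where
    open ≡-Reasoning
    lemma : ∀ k →
      (1ℤ + k) * ((+ 2 + k) * (+ 3 + k) + (+ 2 + k))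
      + ((1ℤ + k) * (+ 3 + k) + (+ 2 + k) + (1ℤ + k))
      + ((1ℤ + k) * (+ 2 + k) + (1ℤ + k))
      ≡ (k + + 3) * (k + + 3) * (k + + 3) - + 3 * (k + + 3) - 1ℤ
    lemma = solve-∀

puu-below : ∀ l {s} → 1 ≤ s → s ≤ 2 ^ l → (p ⊛ uu) (2 ^ suc l ∸ s)
            ≡ + suc l * (1ℤ + (2^ℤ (suc l) - + s)) - (2^ℤ (suc l) - 1ℤ)
puu-below l {s} 1≤s s≤2^l = trans (p⊛-below l 1≤s s≤2^l uu) (trans
  (∑<-cong (suc l) term) (trans (∑<-linear (suc l) (1ℤ + (2^ℤ (suc l) - + s)) 1ℤ)
  (cong (λ y → + suc l * (1ℤ + (2^ℤ (suc l) - + s)) - y) (ℤ.*-identityˡ (2^ℤ (suc l) - 1ℤ)))))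
  where
  open ≡-Reasoning
  lemma : ∀ x s y → 1ℤ + (x - (s + y)) ≡ 1ℤ + (x - s) - 1ℤ * y
  lemma = solve-∀
  term : ∀ {j} → j < suc l →
         uu (2 ^ suc l ∸ (s ℕ.+ 2 ^ j)) ≡ 1ℤ + (2^ℤ (suc l) - + s) - 1ℤ * 2^ℤ j
  term {j} j<1+l = begin
    uu (2 ^ suc l ∸ (s ℕ.+ 2 ^ j))          ≡⟨ uu-eval (2 ^ suc l ∸ (s ℕ.+ 2 ^ j)) ⟩
    1ℤ + + (2 ^ suc l ∸ (s ℕ.+ 2 ^ j))      ≡⟨ cong (_+_ 1ℤ) (pos-∸ (+2^≤2^ s≤2^l (ℕ.s≤s⁻¹ j<1+l))) ⟩
    1ℤ + (2^ℤ (suc l) - (+ s + 2^ℤ j))      ≡⟨ lemma (2^ℤ (suc l)) (+ s) (2^ℤ j) ⟩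
    1ℤ + (2^ℤ (suc l) - + s) - 1ℤ * 2^ℤ j   ∎

-- Twice each summand is a quadratic in 2^j, so `∑<-quadratic` applies; 6 is the 2 of `uuu-eval`
-- times the 3 of that sum.
puuu-below : ∀ l {s} → 1 ≤ s → s ≤ 2 ^ l → + 6 * (p ⊛ uuu) (2 ^ suc l ∸ s)
  ≡ (let x = 2^ℤ (suc l); v = 1ℤ + (x - + s); w = + 2 + (x - + s) in
     + 3 * + suc l * v * w - + 3 * (v + w) * (x - 1ℤ) + (x * x - 1ℤ))
puuu-below l {s} 1≤s s≤2^l = begin
  + 6 * (p ⊛ uuu) (2 ^ suc l ∸ s)   ≡⟨ cong (+ 6 *_) (p⊛-below l 1≤s s≤2^l uuu) ⟩
  + 6 * ∑< (suc l) f                ≡⟨ ℤ.*-assoc (+ 3) (+ 2) (∑< (suc l) f) ⟩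
  + 3 * (+ 2 * ∑< (suc l) f)
    ≡⟨ cong (+ 3 *_) (trans (∑<-distribˡ (suc l) (+ 2) f) (∑<-cong (suc l) term)) ⟩
  + 3 * ∑< (suc l) (λ j → (v - 2^ℤ j) * (w - 2^ℤ j))
    ≡⟨ ∑<-quadratic (suc l) v w ⟩
  + 3 * + suc l * v * w - + 3 * (v + w) * (x - 1ℤ) + (x * x - 1ℤ) ∎
  where
  open ≡-Reasoning
  x = 2^ℤ (suc l)
  v = 1ℤ + (x - + s)
  w = + 2 + (x - + s)
  f : ℕ → ℤ
  f j = uuu (2 ^ suc l ∸ (s ℕ.+ 2 ^ j))
  lemma : ∀ x s y → (+ 1 + (x - (s + y))) * (+ 2 + (x - (s + y)))
                    ≡ (1ℤ + (x - s) - y) * (+ 2 + (x - s) - y)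
  lemma = solve-∀
  term : ∀ {j} → j < suc l → + 2 * f j ≡ (v - 2^ℤ j) * (w - 2^ℤ j)
  term {j} j<1+l = begin
    + 2 * f j          ≡⟨ uuu-eval (2 ^ suc l ∸ (s ℕ.+ 2 ^ j)) ⟩
    _  ≡⟨ cong (λ z → (+ 1 + z) * (+ 2 + z)) (pos-∸ (+2^≤2^ s≤2^l (ℕ.s≤s⁻¹ j<1+l))) ⟩
    _  ≡⟨ lemma x (+ s) (2^ℤ j) ⟩
    (v - 2^ℤ j) * (w - 2^ℤ j)       ∎

-- For all but the top exponent j the inner value from `puu-below` is affine in 2^j, and `∑<-linear`
-- sums it.
ppuu-eval : ∀ {l} → 2 ≤ l → (p ⊛ (p ⊛ uu)) (2 ^ (2 ℕ.+ l) ∸ 3)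
  ≡ (let k = + l + + 2; x = 2^ℤ (suc (suc l)) in
     k * k * (x - + 2) - + 2 * k * (x - 1ℤ) + + 2)
ppuu-eval {l} 2≤l = begin
  (p ⊛ (p ⊛ uu)) (2 ^ (2 ℕ.+ l) ∸ 3)
    ≡⟨ p⊛-below (suc l) 1≤3+ (3≤2^ (ℕ.m≤n⇒m≤1+n 2≤l)) (p ⊛ uu) ⟩
  ∑< (suc l) (λ j → (p ⊛ uu) (2 ^ (2 ℕ.+ l) ∸ (3 ℕ.+ 2 ^ j)))
    + (p ⊛ uu) (2 ^ (2 ℕ.+ l) ∸ (3 ℕ.+ 2 ^ suc l))
    ≡⟨ cong₂ _+_ generic (trans (cong (p ⊛ uu) (2^-∸-cancel (suc l) 3))
                                (puu-below l 1≤3+ (3≤2^ 2≤l))) ⟩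
  summed x           ≡⟨ cong summed (2^ℤ-suc (suc l)) ⟩
  summed (+ 2 * h)   ≡⟨ lemma (+ l) h ⟩
  closed (+ 2 * h)   ≡⟨ cong closed (2^ℤ-suc (suc l)) ⟨
  closed x           ∎
  where
  open ≡-Reasoning
  h = 2^ℤ (suc l)
  x = 2^ℤ (suc (suc l))
  z summed closed : ℤ → ℤ
  z x = + suc (suc l) * (1ℤ + (x - + 3)) - (x - 1ℤ)
  summed x = + suc l * z x - + suc (suc l) * (h - 1ℤ) + (+ suc l * (1ℤ + (h - + 3)) - (h - 1ℤ))
  closed x = (+ l + + 2) * (+ l + + 2) * (x - + 2) - + 2 * (+ l + + 2) * (x - 1ℤ) + + 2
  lemma₁ : ∀ k x y → k * (1ℤ + (x - (+ 3 + y))) - (x - 1ℤ)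
                     ≡ (k * (1ℤ + (x - + 3)) - (x - 1ℤ)) - k * y
  lemma₁ = solve-∀
  generic : ∑< (suc l) (λ j → (p ⊛ uu) (2 ^ (2 ℕ.+ l) ∸ (3 ℕ.+ 2 ^ j)))
            ≡ + suc l * z x - + suc (suc l) * (h - 1ℤ)
  generic = trans
    (∑<-cong (suc l) λ {j} j<1+l → trans
      (puu-below (suc l) 1≤3+ (3+2^≤2^ 2≤l (ℕ.s≤s⁻¹ j<1+l)))
      (lemma₁ (+ suc (suc l)) x (2^ℤ j)))
    (∑<-linear (suc l) (z x) (+ suc (suc l)))
  lemma : ∀ l h →
    (1ℤ + l) * ((+ 2 + l) * (1ℤ + (+ 2 * h - + 3)) - (+ 2 * h - 1ℤ)) - (+ 2 + l) * (h - 1ℤ)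
      + ((1ℤ + l) * (1ℤ + (h - + 3)) - (h - 1ℤ))
    ≡ (l + + 2) * (l + + 2) * (+ 2 * h - + 2) - + 2 * (l + + 2) * (+ 2 * h - 1ℤ) + + 2
  lemma = solve-∀

-- Sums of few powers of 2 and the vanishing of p⁴

data SumOf≤_Powers : ℕ → ℕ → Set where
  []  : ∀ {t} → SumOf≤ t Powers 0
  _∷_ : ∀ {t n} j → SumOf≤ t Powers n → SumOf≤ suc t Powers (2 ^ j ℕ.+ n)

weaken : ∀ {t n} → SumOf≤ t Powers n → SumOf≤ suc t Powers n
weaken []      = []
weaken (j ∷ s) = j ∷ weaken s

-- Summands above 1 are halved, two summands 1 merge into a single 1 of the half, and a leftover 1
-- is discarded and lowers the bound. Merging leaves fewer summands, hence "at most t" rather than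
-- "exactly t".
halve : ∀ {t n} → SumOf≤ t Powers n →
        (∃ λ q → n ≡ 2 ℕ.* q × SumOf≤ t Powers q) ⊎
        (∃₂ λ q r → t ≡ suc r × n ≡ suc (2 ℕ.* q) × SumOf≤ r Powers q)
halve []      = inj₁ (0 , refl , [])
halve (j ∷ s) with j | halve s
... | zero  | inj₁ (q , refl , s′)            = inj₂ (q , _ , refl , refl , s′)
... | zero  | inj₂ (q , r , refl , refl , s′) =
  inj₁ (suc q , sym (ℕ.*-suc 2 q) , weaken (0 ∷ s′))
... | suc j | inj₁ (q , refl , s′)            =
  inj₁ (2 ^ j ℕ.+ q , sym (ℕ.*-distribˡ-+ 2 (2 ^ j) q) , j ∷ s′)
... | suc j | inj₂ (q , r , refl , refl , s′) =
  inj₂ (2 ^ j ℕ.+ q , suc r , refl ,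
        trans (ℕ.+-suc (2 ^ suc j) (2 ℕ.* q)) (cong suc (sym (ℕ.*-distribˡ-+ 2 (2 ^ j) q))) ,
        j ∷ s′)

halve-even : ∀ {t q} → SumOf≤ t Powers (2 ℕ.* q) → SumOf≤ t Powers q
halve-even {t} {q} s with halve s
... | inj₁ (q′ , eq , s′)         = subst (SumOf≤ t Powers) (ℕ.*-cancelˡ-≡ q′ q 2 (sym eq)) s′
... | inj₂ (q′ , _ , _ , eq , _)  = contradiction eq (ℕ.even≢odd q q′)

halve-odd : ∀ {t q} → SumOf≤ t Powers (suc (2 ℕ.* q)) → ∃ λ r → t ≡ suc r × SumOf≤ r Powers q
halve-odd {t} {q} s with halve s
... | inj₁ (q′ , eq , _)            = contradiction (sym eq) (ℕ.even≢odd q′ q)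
... | inj₂ (q′ , r , t≡1+r , eq , s′) =
  r , t≡1+r , subst (SumOf≤ r Powers) (ℕ.*-cancelˡ-≡ q′ q 2 (ℕ.suc-injective (sym eq))) s′

allOnes : ℕ → ℕ
allOnes zero    = 0
allOnes (suc k) = suc (2 ℕ.* allOnes k)

1+allOnes : ∀ k → suc (allOnes k) ≡ 2 ^ k
1+allOnes zero    = refl
1+allOnes (suc k) = trans (sym (ℕ.*-suc 2 (allOnes k))) (cong (2 ℕ.*_) (1+allOnes k))

-- 2^k - 1 is odd, and so are its successive halves: each of the k halvings uses up one summand.
allOnes-powers : ∀ {t} k → SumOf≤ t Powers (allOnes k) → k ≤ t
allOnes-powers zero    s = z≤n
allOnes-powers (suc k) s with halve-odd {q = allOnes k} s
... | r , refl , s′ = s≤s (allOnes-powers k s′)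

2^k∸3 : ∀ k → 2 ^ (2 ℕ.+ k) ∸ 3 ≡ suc (2 ℕ.* (2 ℕ.* allOnes k))
2^k∸3 k = cong (_∸ 3)
  (trans (cong (λ x → 2 ℕ.* (2 ℕ.* x)) (sym (1+allOnes k))) (lemma (allOnes k)))
  where
  lemma : ∀ x → 2 ℕ.* (2 ℕ.* suc x) ≡ 4 ℕ.+ 2 ℕ.* (2 ℕ.* x)
  lemma = ℕ-solve-∀

-- The binary expansion 1⋯101 has k + 1 ≥ 5 ones: the final 1 takes one summand, and three cannot
-- give k ≥ 4 further ones.
¬4-powers : ∀ {k} → 4 ≤ k → ¬ SumOf≤ 4 Powers (2 ^ (2 ℕ.+ k) ∸ 3)
¬4-powers {k} 4≤k s with halve-odd {q = 2 ℕ.* allOnes k} (subst (SumOf≤ 4 Powers) (2^k∸3 k) s)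
... | _ , refl , s′ = ℕ.<⇒≱ 4≤k (allOnes-powers k (halve-even {q = allOnes k} s′))

⊛-vanish : ∀ f g n → (∀ {i j} → i ℕ.+ j ≡ n → f i * g j ≡ 0ℤ) → (f ⊛ g) n ≡ 0ℤ
⊛-vanish f g zero    fg≡0 = cong (_+ 0ℤ) (fg≡0 {0} {0} refl)
⊛-vanish f g (suc n) fg≡0 =
  cong₂ _+_ (fg≡0 {0} refl) (⊛-vanish (tail f) g n λ i+j≡n → fg≡0 (cong suc i+j≡n))

-- A support argument: a nonzero summand pairs a power of 2 with an index in the support of g.
p⊛-vanish : ∀ {t g} → (∀ {m} → ¬ SumOf≤ t Powers m → g m ≡ 0ℤ) →
            ∀ {n} → ¬ SumOf≤ suc t Powers n → (p ⊛ g) n ≡ 0ℤ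
p⊛-vanish {t} {g} g≡0 {n} ¬s = ⊛-vanish p g n λ {i} {j} → term i j
  where
  term : ∀ i j → i ℕ.+ j ≡ n → p i * g j ≡ 0ℤ
  term i j refl with powerOf2? i
  ... | yes (e , refl) = trans (cong (p i *_) (g≡0 (¬s ∘ (e ∷_)))) (ℤ.*-zeroʳ (p i))
  ... | no  i≢2^       = cong (_* g j) (p-¬powerOf2 i≢2^)

p-vanish : ∀ {n} → ¬ SumOf≤ 1 Powers n → p n ≡ 0ℤ
p-vanish {n} ¬s = p-¬powerOf2 {n} λ { (j , refl) →
  ¬s (subst (SumOf≤ 1 Powers) (ℕ.+-identityʳ (2 ^ j)) (j ∷ [])) }

pppp-vanish : ∀ {k} → 4 ≤ k → (p ⊛ (p ⊛ (p ⊛ p))) (2 ^ (2 ℕ.+ k) ∸ 3) ≡ 0ℤ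
pppp-vanish 4≤k = p⊛-vanish {3} {p ⊛ (p ⊛ p)}
  (p⊛-vanish {2} {p ⊛ p} (p⊛-vanish {1} {p} p-vanish)) (¬4-powers 4≤k)

-- The closed form of 6c(2^k - 3) is a polynomial in k and 2^k; putting 0 for 2^k leaves 16R(k).
R : ℤ → ℤ
R k = + 35 + + 51 * k - + 18 * (k * k) - + 12 * (k * k * k)

-- Writing k = 4 + e makes 2^k equal to 16 · 2^e, so 16 can be taken out of the terms containing 2^k
-- as well. The bound 2 ≤ e is what the vanishing of p⁴ requires.
6c-eval : ∀ {e} → 2 ≤ e →
  ∃ λ z → + 6 * c (2 ^ (4 ℕ.+ e) ∸ 3) ≡ + 16 * (R (+ (4 ℕ.+ e)) + 2^ℤ e * z)
6c-eval {e} 2≤e = z , (begin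
  + 6 * c n
    ≡⟨ lemma₁ (c n) A D U B E (c-expansion n) ⟩
  + 6 * U + + 144 * B + + 96 * E - + 8 * (+ 6 * A) - + 192 * D
    ≡⟨ cong₂ _-_ (cong₂ _-_ (cong₂ _+_ (cong₂ (λ x y → x + + 144 * y) U≡ B≡) (cong (+ 96 *_) E≡))
                            (cong (+ 8 *_) A≡)) (cong (+ 192 *_) D≡) ⟩
  closed (2^ℤ (4 ℕ.+ e))
    ≡⟨ cong closed x≡16w ⟩
  closed (+ 16 * 2^ℤ e)
    ≡⟨ lemma₂ (+ e) (2^ℤ e) ⟩
  + 16 * (R (+ (4 ℕ.+ e)) + 2^ℤ e * z) ∎)
  where
  open ≡-Reasoning
  n = 2 ^ (4 ℕ.+ e) ∸ 3
  K = + 4 + + e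
  A = (p ⊛ uuu) n
  B = (p ⊛ (p ⊛ uu)) n
  D = (p ⊛ (p ⊛ (p ⊛ u))) n
  E = (p ⊛ (p ⊛ (p ⊛ p))) n
  U = uuuu n
  -- With x = 2^k, this is the quotient of `closed x - closed 0ℤ` by x.
  z : ℤ
  z = let x = + 16 * 2^ℤ e in
    x * x - + 3 * x + + 2 - + 8 * x * (+ 3 * K - + 5)
    + + 8 * (+ 9 * K - + 15) + + 144 * (K * K - + 2 * K)
  closed : ℤ → ℤ
  closed x =
    (+ 1 + (x - + 3)) * (+ 2 + (x - + 3)) * (+ 3 + (x - + 3))
    + + 144 * ((+ 2 + + e + + 2) * (+ 2 + + e + + 2) * (x - + 2)
               - + 2 * (+ 2 + + e + + 2) * (x - 1ℤ) + + 2)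
    + + 96 * 0ℤ
    - + 8 * (+ 3 * (+ 4 + + e) * (1ℤ + (x - + 3)) * (+ 2 + (x - + 3))
             - + 3 * (1ℤ + (x - + 3) + (+ 2 + (x - + 3))) * (x - 1ℤ) + (x * x - 1ℤ))
    - + 192 * ((+ 1 + + e + + 3) * (+ 1 + + e + + 3) * (+ 1 + + e + + 3)
               - + 3 * (+ 1 + + e + + 3) - 1ℤ)
  3≤ : 3 ≤ 2 ^ (3 ℕ.+ e)
  3≤ = 3≤2^ {3 ℕ.+ e} (s≤s (s≤s z≤n))
  U≡ = trans (uuuu-eval n) (cong (λ y → (+ 1 + y) * (+ 2 + y) * (+ 3 + y))
    (pos-∸ {2 ^ (4 ℕ.+ e)} {3} (3≤2^ {4 ℕ.+ e} (s≤s (s≤s z≤n)))))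
  B≡ = ppuu-eval {2 ℕ.+ e} (s≤s (s≤s z≤n))
  E≡ = pppp-vanish {2 ℕ.+ e} (s≤s (s≤s 2≤e))
  A≡ = puuu-below (3 ℕ.+ e) {3} (s≤s z≤n) 3≤
  D≡ = pppu-eval {suc e} (ℕ.m≤n⇒m≤1+n 2≤e)
  x≡16w : 2^ℤ (4 ℕ.+ e) ≡ + 16 * 2^ℤ e
  x≡16w = trans (cong +_ (ℕ.^-distribˡ-+-* 2 4 e)) (ℤ.pos-* 16 (2 ^ e))
  lemma₁ : ∀ c A D U B E → c + (+ 8 * A + + 32 * D) ≡ U + (+ 24 * B + + 16 * E) →
    + 6 * c ≡ + 6 * U + + 144 * B + + 96 * E - + 8 * (+ 6 * A) - + 192 * D
  lemma₁ c A D U B E eq = trans (before c A D)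
    (trans (cong (λ y → + 6 * y - + 8 * (+ 6 * A) - + 192 * D) eq) (after A D U B E))
    where
    before : ∀ c A D → + 6 * c ≡ + 6 * (c + (+ 8 * A + + 32 * D)) - + 8 * (+ 6 * A) - + 192 * D
    before = solve-∀
    after : ∀ A D U B E → + 6 * (U + (+ 24 * B + + 16 * E)) - + 8 * (+ 6 * A) - + 192 * D
      ≡ + 6 * U + + 144 * B + + 96 * E - + 8 * (+ 6 * A) - + 192 * D
    after = solve-∀
  lemma₂ : ∀ e w →
    (+ 1 + (+ 16 * w - + 3)) * (+ 2 + (+ 16 * w - + 3)) * (+ 3 + (+ 16 * w - + 3))
    + + 144 * ((+ 2 + e + + 2) * (+ 2 + e + + 2) * (+ 16 * w - + 2)
               - + 2 * (+ 2 + e + + 2) * (+ 16 * w - 1ℤ) + + 2)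
    + + 96 * 0ℤ
    - + 8 * (+ 3 * (+ 4 + e) * (1ℤ + (+ 16 * w - + 3)) * (+ 2 + (+ 16 * w - + 3))
             - + 3 * (1ℤ + (+ 16 * w - + 3) + (+ 2 + (+ 16 * w - + 3))) * (+ 16 * w - 1ℤ)
             + (+ 16 * w * (+ 16 * w) - 1ℤ))
    - + 192 * ((+ 1 + e + + 3) * (+ 1 + e + + 3) * (+ 1 + e + + 3) - + 3 * (+ 1 + e + + 3) - 1ℤ)
    ≡ + 16 * (+ 35 + + 51 * (+ 4 + e) - + 18 * ((+ 4 + e) * (+ 4 + e))
              - + 12 * ((+ 4 + e) * (+ 4 + e) * (+ 4 + e))
      + w * ((+ 16 * w) * (+ 16 * w) - + 3 * (+ 16 * w) + + 2
             - + 8 * (+ 16 * w) * (+ 3 * (+ 4 + e) - + 5)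
             + + 8 * (+ 9 * (+ 4 + e) - + 15) + + 144 * ((+ 4 + e) * (+ 4 + e) - + 2 * (+ 4 + e))))
  lemma₂ = solve-∀

-- Automata

value : List Bit → ℕ
value []       = 0
value (d ∷ ds) = toℕ d ℕ.+ 2 ℕ.* value ds

value-increment : ∀ ds → value (increment ds) ≡ suc (value ds)
value-increment []              = refl
value-increment (zero     ∷ ds) = refl
value-increment (suc zero ∷ ds) =
  trans (cong (2 ℕ.*_) (value-increment ds)) (ℕ.*-suc 2 (value ds))

value-bits : ∀ n → value (bits n) ≡ n
value-bits zero    = refl
value-bits (suc n) = trans (value-increment (bits n)) (cong suc (value-bits n))

module _ {A : Set} (M : DFAO A) where
  open DFAO M

  -- Reading the reversed digit list from the left is a right fold over the digits, so a new lowest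
  -- digit acts by one outermost step.
  stateLSD : List Bit → Fin states
  stateLSD = foldr (flip step) start

  run-binary : ∀ n → run (binary n) ≡ out (stateLSD (bits n))
  run-binary n = cong out (reverse-foldl step start (bits n))

-- The states record whether no, exactly one, or more than one digit 1 has been read.
powerOf2-DFAO : DFAO ℤ
powerOf2-DFAO = record
  { states = 3 ; start = zero ; step = δ ; out = λ { (suc zero) → -1ℤ ; _ → 1ℤ } }
  where
  δ : Fin 3 → Bit → Fin 3
  δ zero             zero       = zero
  δ zero             (suc zero) = suc zero
  δ (suc zero)       zero       = suc zero
  δ (suc zero)       (suc zero) = suc (suc zero)
  δ (suc (suc zero)) _          = suc (suc zero)

Characterises : Fin 3 → ℕ → Set
Characterises zero             n = n ≡ 0
Characterises (suc zero)       n = IsPowerOf2 n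
Characterises (suc (suc zero)) n = n ≢ 0 × ¬ IsPowerOf2 n

odd-powerOf2 : ∀ {n} → IsPowerOf2 (suc (2 ℕ.* n)) → n ≡ 0
odd-powerOf2 {n} (zero  , eq) = ℕ.*-cancelˡ-≡ n 0 2 (ℕ.suc-injective eq)
odd-powerOf2 {n} (suc j , eq) = contradiction (sym eq) (ℕ.even≢odd (2 ^ j) n)

even-powerOf2 : ∀ {n} → IsPowerOf2 (2 ℕ.* n) → IsPowerOf2 n
even-powerOf2 {n} (zero  , eq) = contradiction eq (ℕ.even≢odd n 0)
even-powerOf2 {n} (suc j , eq) = j , ℕ.*-cancelˡ-≡ n (2 ^ j) 2 eq

state-characterises : ∀ ds → Characterises (stateLSD powerOf2-DFAO ds) (value ds)
state-characterises []       = refl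
state-characterises (d ∷ ds) with stateLSD powerOf2-DFAO ds | state-characterises ds | d
... | zero           | v≡0         | zero     = cong (2 ℕ.*_) v≡0
... | zero           | v≡0         | suc zero = 0 , cong (λ v → suc (2 ℕ.* v)) v≡0
... | suc zero       | j , v≡2^j   | zero     = suc j , cong (2 ℕ.*_) v≡2^j
... | suc zero       | j , v≡2^j   | suc zero =
  (λ ()) , λ pow → contradiction (trans (sym v≡2^j) (odd-powerOf2 pow))
                                 (ℕ.≢-nonZero⁻¹ (2 ^ j) {{ℕ.m^n≢0 2 j}})
... | suc (suc zero) | v≢0 , ¬pow  | zero     =
  v≢0 ∘ ℕ.*-cancelˡ-≡ _ 0 2 , ¬pow ∘ even-powerOf2
... | suc (suc zero) | v≢0 , ¬pow  | suc zero = (λ ()) , v≢0 ∘ odd-powerOf2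

a-automatic : 2-Automatic a
a-automatic = powerOf2-DFAO , λ n → trans (run-binary powerOf2-DFAO n)
  (output (stateLSD powerOf2-DFAO (bits n))
    (subst (Characterises _) (value-bits n) (state-characterises (bits n))))
  where
  output : ∀ {n} s → Characterises s n → DFAO.out powerOf2-DFAO s ≡ a n
  output zero refl = refl
  output {n} (suc zero) pow =
    sym (cong (if_then -1ℤ else 1ℤ) (dec-true (powerOf2? n) pow))
  output {n} (suc (suc zero)) (_ , ¬pow) =
    sym (cong (if_then -1ℤ else 1ℤ) (dec-false (powerOf2? n) ¬pow))

-- Proved jointly with the even case, since `increment` passes from each parity to the other. The
-- even case needs a positive half because `bits 0` is the empty word.
bits-suc-double : ∀ n → bits (suc (2 ℕ.* n)) ≡ 1b ∷ bits n
bits-double : ∀ n → bits (2 ℕ.* suc n) ≡ 0b ∷ bits (suc n)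
bits-suc-double zero    = refl
bits-suc-double (suc n) = cong increment (bits-double n)
bits-double n = trans (cong bits (ℕ.*-suc 2 n)) (cong increment (bits-suc-double n))

bits-allOnes : ∀ n → bits (allOnes n) ≡ replicate n 1b
bits-allOnes zero    = refl
bits-allOnes (suc n) = trans (bits-suc-double (allOnes n)) (cong (1b ∷_) (bits-allOnes n))

bits-2^∸3 : ∀ n → bits (2 ^ (3 ℕ.+ n) ∸ 3) ≡ 1b ∷ 0b ∷ replicate (suc n) 1b
bits-2^∸3 n = trans (cong bits (2^k∸3 (suc n)))
  (trans (bits-suc-double (2 ℕ.* allOnes (suc n)))
    (cong (1b ∷_) (trans (bits-double (2 ℕ.* allOnes n))
      (cong (0b ∷_) (bits-allOnes (suc n))))))

-- Signed odd parts

Even Odd : ℤ → Set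
Even z = ∃ λ v → z ≡ + 2 * v
Odd  z = ∃ λ v → z ≡ 1ℤ + + 2 * v

even-or-odd : ∀ z → Even z ⊎ Odd z
even-or-odd z with z %ℕ 2 | n%ℕd<d z 2 | a≡a%ℕn+[a/ℕn]*n z 2
... | 0           | _            | eq =
  inj₁ (z /ℕ 2 , trans eq (trans (ℤ.+-identityˡ _) (ℤ.*-comm (z /ℕ 2) (+ 2))))
... | 1           | _            | eq =
  inj₂ (z /ℕ 2 , trans eq (cong (_+_ 1ℤ) (ℤ.*-comm (z /ℕ 2) (+ 2))))
... | suc (suc _) | s≤s (s≤s ()) | _

even⇒¬odd : ∀ {z} → Even z → ¬ Odd z
even⇒¬odd (v , refl) (w , eq) = ℕ.even≢odd ∣ v - w ∣ 0 (sym (trans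
  (cong ∣_∣ (trans (lemma₁ w) (trans (cong (_- + 2 * w) (sym eq)) (lemma₂ v w))))
  (ℤ.abs-* (+ 2) (v - w))))
  where
  lemma₁ : ∀ w → 1ℤ ≡ 1ℤ + + 2 * w - + 2 * w
  lemma₁ = solve-∀
  lemma₂ : ∀ v w → + 2 * v - + 2 * w ≡ + 2 * (v - w)
  lemma₂ = solve-∀

-- Common factors 2 are cancelled; if one exponent runs out first, an odd number equals an even one.
odd-part-unique : ∀ m n {x y} → Odd x → Odd y → 2^ℤ m * x ≡ 2^ℤ n * y → x ≡ y
odd-part-unique zero    zero    {x} {y} _ _ eq =
  trans (sym (ℤ.*-identityˡ x)) (trans eq (ℤ.*-identityˡ y))
odd-part-unique zero    (suc n) {x} {y} x-odd _ eq = contradiction x-odd (even⇒¬odd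
  (2^ℤ n * y , trans (sym (ℤ.*-identityˡ x))
    (trans eq (trans (cong (_* y) (2^ℤ-suc n)) (ℤ.*-assoc (+ 2) (2^ℤ n) y)))))
odd-part-unique (suc m) zero    x-odd y-odd eq =
  sym (odd-part-unique zero (suc m) y-odd x-odd (sym eq))
odd-part-unique (suc m) (suc n) {x} {y} x-odd y-odd eq = odd-part-unique m n x-odd y-odd
  (ℤ.*-cancelˡ-≡ (+ 2) (2^ℤ m * x) (2^ℤ n * y) (trans (double m x) (trans eq (sym (double n y)))))
  where
  double : ∀ k z → + 2 * (2^ℤ k * z) ≡ 2^ℤ (suc k) * z
  double k z = trans (sym (ℤ.*-assoc (+ 2) (2^ℤ k) z)) (cong (_* z) (sym (2^ℤ-suc k)))

∣⇒%ℕ≡0 : ∀ z d .{{_ : ℕ.NonZero d}} → + d ∣ z → z %ℕ d ≡ 0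
∣⇒%ℕ≡0 (+ n)    d d∣z = n∣m⇒m%n≡0 n d d∣z
∣⇒%ℕ≡0 -[1+ n ] d d∣z with suc n ℕ.% d | n∣m⇒m%n≡0 (suc n) d d∣z
... | zero | _ = refl

∣⇒≡/ℕ : ∀ z d .{{_ : ℕ.NonZero d}} → + d ∣ z → z ≡ + d * (z /ℕ d)
∣⇒≡/ℕ z d d∣z = trans (a≡a%ℕn+[a/ℕn]*n z d) (trans
  (cong (λ r → + r + (z /ℕ d) * + d) (∣⇒%ℕ≡0 z d d∣z))
  (trans (ℤ.+-identityˡ _) (ℤ.*-comm (z /ℕ d) (+ d))))

-- An even quotient would make 2^(ν + 1) divide z, against the maximality of ν = `ν₂ z`.
odd-quotient : ∀ z .{{_ : ℤ.NonZero z}} → let q = _/ℕ_ z (2 ^ ν₂ z) {{ℕ.m^n≢0 2 (ν₂ z)}} in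
               z ≡ 2^ℤ (ν₂ z) * q × Odd q
odd-quotient z = z≡ , q-odd
  where
  instance 2^≢0 = ℕ.m^n≢0 2 (ν₂ z)
  q = z /ℕ (2 ^ ν₂ z)
  z≡ : z ≡ 2^ℤ (ν₂ z) * q
  z≡ = ∣⇒≡/ℕ z (2 ^ ν₂ z) (proj₁ (proj₂ (twoAdicOrder z)))
  q-odd : Odd q
  q-odd with even-or-odd q
  ... | inj₂ odd-q      = odd-q
  ... | inj₁ (w , q≡2w) =
    contradiction (proj₂ (proj₂ (twoAdicOrder z)) (suc (ν₂ z)) 2^∣z) ℕ.1+n≰n
    where
    z≡′ : z ≡ 2^ℤ (suc (ν₂ z)) * w
    z≡′ = trans z≡ (trans (cong (2^ℤ (ν₂ z) *_) q≡2w)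
      (trans (lemma (2^ℤ (ν₂ z)) w) (cong (_* w) (sym (2^ℤ-suc (ν₂ z))))))
      where
      lemma : ∀ x w → x * (+ 2 * w) ≡ + 2 * x * w
      lemma = solve-∀
    2^∣z : 2^ℤ (suc (ν₂ z)) ∣ z
    2^∣z = subst (2 ^ suc (ν₂ z) ∣ℕ_)
      (sym (trans (cong ∣_∣ z≡′) (ℤ.abs-* (2^ℤ (suc (ν₂ z))) w))) (m∣m*n ∣ w ∣)

odd-spec : ∀ z → z ≢ 0ℤ → ∃ λ v → z ≡ 2^ℤ v * odd z × Odd (odd z)
odd-spec (+ zero)     z≢0 = contradiction refl z≢0
odd-spec z@(+ suc _)  _   = ν₂ z , odd-quotient z
odd-spec z@(-[1+ _ ]) _   = ν₂ z , odd-quotient z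

-- 2-adic orders of the values of R

R-slope : ℤ → ℤ → ℤ
R-slope k h = + 25 - + 9 * (+ 2 * k + h) - + 6 * (+ 3 * (k * k) + + 3 * (k * h) + h * h)

-- Apart from 51, all coefficients of the difference quotient of R are even, so the quotient is odd
-- for all k and h.
R-shift : ∀ k h → R (k + h) ≡ R k + h * (1ℤ + + 2 * R-slope k h)
R-shift = lemma
  where
  lemma : ∀ k h →
    + 35 + + 51 * (k + h) - + 18 * ((k + h) * (k + h)) - + 12 * ((k + h) * (k + h) * (k + h))
    ≡ + 35 + + 51 * k - + 18 * (k * k) - + 12 * (k * k * k)
      + h * (1ℤ + + 2 * (+ 25 - + 9 * (+ 2 * k + h)
                         - + 6 * (+ 3 * (k * k) + + 3 * (k * h) + h * h)))
  lemma = solve-∀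

R-shift-2^ : ∀ t k {w} → R (+ k) ≡ 2^ℤ t * w →
  R (+ (k ℕ.+ 2 ^ t)) ≡ 2^ℤ t * (w + (1ℤ + + 2 * R-slope (+ k) (2^ℤ t)))
R-shift-2^ t k {w} eq = trans (R-shift (+ k) (2^ℤ t))
  (trans (cong (_+ 2^ℤ t * s) eq) (sym (ℤ.*-distribˡ-+ (2^ℤ t) w s)))
  where s = 1ℤ + + 2 * R-slope (+ k) (2^ℤ t)

-- The Hensel step: if R(k)/2^t is odd, replacing k by k + 2^t adds an odd number to it. As k only
-- grows, the lower bound b is kept.
R-divisible : ∀ t b → ∃ λ k → b ≤ k × ∃ λ w → R (+ k) ≡ 2^ℤ t * w
R-divisible zero    b = b , ℕ.≤-refl , R (+ b) , sym (ℤ.*-identityˡ (R (+ b)))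
R-divisible (suc t) b with R-divisible t b
... | k , b≤k , w , eq with even-or-odd w
...   | inj₁ (v , refl) = k , b≤k , v ,
  trans eq (trans (lemma (2^ℤ t) v) (cong (_* v) (sym (2^ℤ-suc t))))
  where
  lemma : ∀ x v → x * (+ 2 * v) ≡ + 2 * x * v
  lemma = solve-∀
...   | inj₂ (v , refl) = k ℕ.+ 2 ^ t , ℕ.≤-trans b≤k (ℕ.m≤m+n k (2 ^ t)) , 1ℤ + v + s ,
  trans (R-shift-2^ t k eq) (trans (lemma (2^ℤ t) v s) (cong (_* (1ℤ + v + s)) (sym (2^ℤ-suc t))))
  where
  s = R-slope (+ k) (2^ℤ t)
  lemma : ∀ x v s → x * (1ℤ + + 2 * v + (1ℤ + + 2 * s)) ≡ + 2 * x * (1ℤ + v + s)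
  lemma = solve-∀

-- The same shift used the other way round: it makes an even cofactor odd.
R-order : ∀ t b → ∃ λ k → b ≤ k × ∃ λ w → Odd w × R (+ k) ≡ 2^ℤ t * w
R-order t b with R-divisible t b
... | k , b≤k , w , eq with even-or-odd w
...   | inj₂ w-odd      = k , b≤k , w , w-odd , eq
...   | inj₁ (v , refl) = k ℕ.+ 2 ^ t , ℕ.≤-trans b≤k (ℕ.m≤m+n k (2 ^ t)) , _ ,
  (v + s , lemma v s) , R-shift-2^ t k eq
  where
  s = R-slope (+ k) (2^ℤ t)
  lemma : ∀ v s → + 2 * v + (1ℤ + + 2 * s) ≡ 1ℤ + + 2 * (v + s)
  lemma = solve-∀

-- Odd parts of c(2^k - 3) modulo 4

2^ℤ-+ : ∀ i j → 2^ℤ (i ℕ.+ j) ≡ 2^ℤ i * 2^ℤ j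
2^ℤ-+ i j = trans (cong +_ (ℕ.^-distribˡ-+-* 2 i j)) (ℤ.pos-* (2 ^ i) (2 ^ j))

-- The error term is divisible by 2^(t+2), so after removing 2^t it changes the cofactor w only by a
-- multiple of 4. Of the factor 6, the 2 joins the power of 2 and the 3 stays with the odd part.
3*odd-part : ∀ t f {x y z v o} →
  + 6 * x ≡ + 16 * (y + 2^ℤ (2 ℕ.+ t ℕ.+ f) * z) →
  ∀ {w} → y ≡ 2^ℤ t * w → Odd w →
  x ≡ 2^ℤ v * o → Odd o →
  + 3 * o ≡ w + + 4 * (2^ℤ f * z)
3*odd-part t f {x} {y} {z} {v} {o} 6x≡ {w} y≡ (i , w≡) x≡ (r , o≡) =
  odd-part-unique (suc v) (4 ℕ.+ t) (1ℤ + + 3 * r , trans (cong (+ 3 *_) o≡) (lemma₁ r))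
    (i + + 2 * (2^ℤ f * z) , trans (cong (_+ + 4 * (2^ℤ f * z)) w≡) (lemma₂ i (2^ℤ f * z))) (begin
      2^ℤ (suc v) * (+ 3 * o)                  ≡⟨ cong (_* (+ 3 * o)) (2^ℤ-suc v) ⟩
      + 2 * 2^ℤ v * (+ 3 * o)                  ≡⟨ lemma₃ (2^ℤ v) o ⟩
      + 6 * (2^ℤ v * o)                        ≡⟨ cong (+ 6 *_) x≡ ⟨
      + 6 * x                                  ≡⟨ 6x≡ ⟩
      + 16 * (y + 2^ℤ (2 ℕ.+ t ℕ.+ f) * z)     ≡⟨ cong₂ (λ y s → + 16 * (y + s * z)) y≡ 2^ℤ-2+t+f ⟩
      + 16 * (2^ℤ t * w + + 4 * 2^ℤ t * 2^ℤ f * z)  ≡⟨ lemma₄ (2^ℤ t) (2^ℤ f) w z ⟩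
      + 16 * 2^ℤ t * (w + + 4 * (2^ℤ f * z))   ≡⟨ cong (_* (w + + 4 * (2^ℤ f * z))) (2^ℤ-+ 4 t) ⟨
      2^ℤ (4 ℕ.+ t) * (w + + 4 * (2^ℤ f * z))  ∎)
  where
  open ≡-Reasoning
  2^ℤ-2+t+f : 2^ℤ (2 ℕ.+ t ℕ.+ f) ≡ + 4 * 2^ℤ t * 2^ℤ f
  2^ℤ-2+t+f = trans (2^ℤ-+ (2 ℕ.+ t) f) (cong (_* 2^ℤ f) (2^ℤ-+ 2 t))
  lemma₁ : ∀ r → + 3 * (1ℤ + + 2 * r) ≡ 1ℤ + + 2 * (1ℤ + + 3 * r)
  lemma₁ = solve-∀
  lemma₂ : ∀ v y → 1ℤ + + 2 * v + + 4 * y ≡ 1ℤ + + 2 * (v + + 2 * y)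
  lemma₂ = solve-∀
  lemma₃ : ∀ x o → + 2 * x * (+ 3 * o) ≡ + 6 * (x * o)
  lemma₃ = solve-∀
  lemma₄ : ∀ x y w z → + 16 * (x * w + + 4 * x * y * z) ≡ + 16 * x * (w + + 4 * (y * z))
  lemma₄ = solve-∀

ω-≡⇒odd-≡ : ∀ {m n} → ω m ≡ ω n → ∃ λ z → odd (c m) ≡ odd (c n) + + 4 * z
ω-≡⇒odd-≡ {m} {n} ωm≡ωn = odd (c m) /ℕ 4 - odd (c n) /ℕ 4 , (begin
  odd (c m)
    ≡⟨ a≡a%ℕn+[a/ℕn]*n (odd (c m)) 4 ⟩
  + (odd (c m) %ℕ 4) + odd (c m) /ℕ 4 * + 4
    ≡⟨ cong (λ r → + r + odd (c m) /ℕ 4 * + 4) residues ⟩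
  + (odd (c n) %ℕ 4) + odd (c m) /ℕ 4 * + 4
    ≡⟨ lemma (+ (odd (c n) %ℕ 4)) (odd (c m) /ℕ 4) (odd (c n) /ℕ 4) ⟩
  + (odd (c n) %ℕ 4) + odd (c n) /ℕ 4 * + 4 + + 4 * (odd (c m) /ℕ 4 - odd (c n) /ℕ 4)
    ≡⟨ cong (_+ + 4 * (odd (c m) /ℕ 4 - odd (c n) /ℕ 4)) (a≡a%ℕn+[a/ℕn]*n (odd (c n)) 4) ⟨
  odd (c n) + + 4 * (odd (c m) /ℕ 4 - odd (c n) /ℕ 4) ∎)
  where
  open ≡-Reasoning
  residues : odd (c m) %ℕ 4 ≡ odd (c n) %ℕ 4
  residues = trans (sym (toℕ-fromℕ< (n%ℕd<d (odd (c m)) 4)))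
                   (trans (cong toℕ ωm≡ωn) (toℕ-fromℕ< (n%ℕd<d (odd (c n)) 4)))
  lemma : ∀ r x y → r + x * + 4 ≡ r + y * + 4 + + 4 * (x - y)
  lemma = solve-∀

-- Rewriting the index by an equation keeps c from being unfolded.
6c-eval-at : ∀ {e k} → 4 ℕ.+ e ≡ k → 2 ≤ e →
             ∃ λ z → + 6 * c (2 ^ k ∸ 3) ≡ + 16 * (R (+ k) + 2^ℤ e * z)
6c-eval-at refl = 6c-eval

-- The 6 in k = 6 + t + f is the 4 from the index of `6c-eval` plus the two binary digits needed
-- modulo 4.
3*odd-c : ∀ t f {k w} → k ≡ 6 ℕ.+ t ℕ.+ f → R (+ k) ≡ 2^ℤ t * w → Odd w →
          ∃ λ z → + 3 * odd (c (2 ^ k ∸ 3)) ≡ w + + 4 * z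
3*odd-c t f {k} {w} k≡ R≡ w-odd =
  let z , 6c≡          = 6c-eval-at {2 ℕ.+ t ℕ.+ f} {k} (sym k≡) (s≤s (s≤s z≤n))
      v , c≡ , odd-odd = odd-spec (c (2 ^ k ∸ 3)) (c≢0 (2 ^ k ∸ 3))
  in 2^ℤ f * z ,
     3*odd-part t f {c (2 ^ k ∸ 3)} {R (+ k)} {z} {v} {odd (c (2 ^ k ∸ 3))}
       6c≡ {w} R≡ w-odd c≡ odd-odd

-- Modulo 4 the triples of o₁ and o₂ differ by 2; a congruence of o₁ and o₂ would make 2 divisible
-- by 4, that is, 1 even.
3o-separates : ∀ {w} T {o₁ o₂} →
  (∃ λ z → + 3 * o₁ ≡ w + + 4 * z) →
  (∃ λ z → + 3 * o₂ ≡ w + (+ 2 + + 4 * T) + + 4 * z) →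
  ¬ (∃ λ z → o₁ ≡ o₂ + + 4 * z)
3o-separates {w} T {o₁} {o₂} (z₁ , 3o₁≡) (z₂ , 3o₂≡) (z , o₁≡) =
  even⇒¬odd (z₁ - T - z₂ - + 3 * z , 1≡2*) (0ℤ , refl)
  where
  before : ∀ w T z₂ z → + 2 * 1ℤ ≡
    (w + (+ 2 + + 4 * T) + + 4 * z₂) + + 12 * z - (w + + 4 * (T + z₂ + + 3 * z))
  before = solve-∀
  factor : ∀ o z → + 3 * o + + 12 * z ≡ + 3 * (o + + 4 * z)
  factor = solve-∀
  after : ∀ w T z₁ z₂ z → w + + 4 * z₁ - (w + + 4 * (T + z₂ + + 3 * z))
                          ≡ + 2 * (+ 2 * (z₁ - T - z₂ - + 3 * z))
  after = solve-∀
  open ≡-Reasoning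
  1≡2* : 1ℤ ≡ + 2 * (z₁ - T - z₂ - + 3 * z)
  1≡2* = ℤ.*-cancelˡ-≡ (+ 2) 1ℤ _ (begin
    + 2 * 1ℤ
      ≡⟨ before w T z₂ z ⟩
    (w + (+ 2 + + 4 * T) + + 4 * z₂) + + 12 * z - (w + + 4 * (T + z₂ + + 3 * z))
      ≡⟨ cong (λ x → x + + 12 * z - (w + + 4 * (T + z₂ + + 3 * z))) 3o₂≡ ⟨
    + 3 * o₂ + + 12 * z - (w + + 4 * (T + z₂ + + 3 * z))
      ≡⟨ cong (_- (w + + 4 * (T + z₂ + + 3 * z)))
              (trans (factor o₂ z) (trans (cong (+ 3 *_) (sym o₁≡)) 3o₁≡)) ⟩
    w + + 4 * z₁ - (w + + 4 * (T + z₂ + + 3 * z))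
      ≡⟨ after w T z₁ z₂ z ⟩
    + 2 * (+ 2 * (z₁ - T - z₂ - + 3 * z)) ∎)

-- The shift has 2-adic order exactly t + 1 and the difference quotient of R is odd, so w changes by
-- twice an odd number, which is 2 modulo 4, while R keeps the order t.
ω-separates : ∀ t f r {k k′ w} → k ≡ 6 ℕ.+ t ℕ.+ f → k′ ≡ k ℕ.+ 2 ^ suc t ℕ.* (1 ℕ.+ 2 ℕ.* r) →
  R (+ k) ≡ 2^ℤ t * w → Odd w → ω (2 ^ k ∸ 3) ≢ ω (2 ^ k′ ∸ 3)
ω-separates t f r {k} {k′} {w} k≡ k′≡ R≡ (v , w≡) ω≡ =
  3o-separates {w} T {odd (c (2 ^ k ∸ 3))} {odd (c (2 ^ k′ ∸ 3))}
    (3*odd-c t f {k} k≡ R≡ (v , w≡))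
    (3*odd-c t (f ℕ.+ h) {k′} (trans k′≡ (trans (cong (ℕ._+ h) k≡) (ℕ.+-assoc (6 ℕ.+ t) f h)))
      R≡′ (v + 1ℤ + + 2 * T , trans (cong (_+ (+ 2 + + 4 * T)) w≡) (lemma₂ v T)))
    (ω-≡⇒odd-≡ {2 ^ k ∸ 3} {2 ^ k′ ∸ 3} ω≡)
  where
  h = 2 ^ suc t ℕ.* (1 ℕ.+ 2 ℕ.* r)
  S = R-slope (+ k) (+ h)
  -- Chosen so that 2(1 + 2r)(1 + 2S) = 2 + 4T.
  T = + r + S + + 2 * (+ r * S)
  h≡ : + h ≡ + 2 * 2^ℤ t * (1ℤ + + 2 * + r)
  h≡ = trans (ℤ.pos-* (2 ^ suc t) (1 ℕ.+ 2 ℕ.* r))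
             (cong₂ _*_ (2^ℤ-suc t) (cong (_+_ 1ℤ) (ℤ.pos-* 2 r)))
  lemma₁ : ∀ x w r s → x * w + + 2 * x * (1ℤ + + 2 * r) * (1ℤ + + 2 * s)
                       ≡ x * (w + (+ 2 + + 4 * (r + s + + 2 * (r * s))))
  lemma₁ = solve-∀
  lemma₂ : ∀ v y → 1ℤ + + 2 * v + (+ 2 + + 4 * y) ≡ 1ℤ + + 2 * (v + 1ℤ + + 2 * y)
  lemma₂ = solve-∀
  R≡′ : R (+ k′) ≡ 2^ℤ t * (w + (+ 2 + + 4 * T))
  R≡′ = trans (cong (R ∘ +_) k′≡) (trans (R-shift (+ k) (+ h))
    (trans (cong₂ (λ x y → x + y * (1ℤ + + 2 * S)) R≡ h≡) (lemma₁ (2^ℤ t) w (+ r) S)))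

-- Non-automaticity

module _ {A : Set} (M : DFAO A) where
  open DFAO M

  onesState : ℕ → Fin states
  onesState n = stateLSD M (replicate n 1b)

  run-2^∸3 : ∀ n → run (binary (2 ^ (3 ℕ.+ n) ∸ 3))
                   ≡ out (step (step (onesState (suc n)) 0b) 1b)
  run-2^∸3 n =
    trans (run-binary M (2 ^ (3 ℕ.+ n) ∸ 3)) (cong (out ∘ stateLSD M) (bits-2^∸3 n))

  onesState-shift : ∀ m {x y} → onesState x ≡ onesState y →
                    onesState (m ℕ.+ x) ≡ onesState (m ℕ.+ y)
  onesState-shift zero    eq = eq
  onesState-shift (suc m) eq = cong (flip step 1b) (onesState-shift m eq)

  -- The pigeonhole is applied only to runs whose length is a power of 2, so the difference of the
  -- two lengths is 2^t times an odd number, and its 2-adic order is known.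
  onesState-collision : ∃₂ λ t s → onesState (2 ^ t) ≡ onesState (2 ^ (suc t ℕ.+ s))
  onesState-collision with pigeonhole (ℕ.n<1+n states) (λ i → onesState (2 ^ toℕ i))
  ... | i , j , i<j , eq with ℕ.m≤n⇒∃[o]m+o≡n i<j
  ...   | s , 1+i+s≡j = toℕ i , s , trans eq (cong (onesState ∘ (2 ^_)) (sym 1+i+s≡j))

  -- The period is twice the difference 2^(t+1+s) − 2^t of the collision.
  onesState-periodic : ∃₂ λ t r → ∀ m →
    onesState (m ℕ.+ 2 ^ t) ≡ onesState (m ℕ.+ 2 ^ t ℕ.+ 2 ^ suc t ℕ.* (1 ℕ.+ 2 ℕ.* r))
  onesState-periodic with onesState-collision
  ... | t , s , eq = t , allOnes s , λ m → begin
    onesState (m ℕ.+ 2 ^ t)                ≡⟨ onesState-shift m eq′ ⟩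
    onesState (m ℕ.+ (d ℕ.+ 2 ^ t))        ≡⟨ cong onesState (ℕ.+-assoc m d (2 ^ t)) ⟨
    onesState (m ℕ.+ d ℕ.+ 2 ^ t)          ≡⟨ onesState-shift (m ℕ.+ d) eq′ ⟩
    onesState (m ℕ.+ d ℕ.+ (d ℕ.+ 2 ^ t))
      ≡⟨ cong onesState (regroup m (2 ^ t) (1 ℕ.+ 2 ℕ.* allOnes s)) ⟩
    onesState (m ℕ.+ 2 ^ t ℕ.+ 2 ^ suc t ℕ.* (1 ℕ.+ 2 ℕ.* allOnes s)) ∎
    where
    open ≡-Reasoning
    d = 2 ^ t ℕ.* (1 ℕ.+ 2 ℕ.* allOnes s)
    distrib : ∀ x y → x ℕ.* (1 ℕ.+ 2 ℕ.* y) ℕ.+ x ≡ 2 ℕ.* (x ℕ.* suc y)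
    distrib = ℕ-solve-∀
    d+2^t≡ : d ℕ.+ 2 ^ t ≡ 2 ^ (suc t ℕ.+ s)
    d+2^t≡ = trans (distrib (2 ^ t) (allOnes s)) (cong (2 ℕ.*_)
      (trans (cong (2 ^ t ℕ.*_) (1+allOnes s)) (sym (ℕ.^-distribˡ-+-* 2 t s))))
    eq′ : onesState (2 ^ t) ≡ onesState (d ℕ.+ 2 ^ t)
    eq′ = trans eq (cong onesState (sym d+2^t≡))
    regroup : ∀ m x y → m ℕ.+ x ℕ.* y ℕ.+ (x ℕ.* y ℕ.+ x) ≡ m ℕ.+ x ℕ.+ 2 ℕ.* x ℕ.* y
    regroup = ℕ-solve-∀

ω-not-automatic : ¬ 2-Automatic ω
ω-not-automatic (M , computes) =
  let t , r , periodic           = onesState-periodic M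
      -- The automaton fixes t first; k is then taken with R(k) of order exactly t. In the bound, 6
      -- + t serves `3*odd-c` and 2^t is the run length from which the states are periodic.
      k , b≤k , w , w-odd , R≡   = R-order t (6 ℕ.+ t ℕ.+ 2 ^ t)
  in contradict t r periodic k b≤k w-odd R≡
  where
  open DFAO M
  ω-run : ∀ k n → k ≡ 3 ℕ.+ n → ω (2 ^ k ∸ 3) ≡ out (step (step (onesState M (suc n)) 0b) 1b)
  ω-run k n k≡ = trans (sym (computes (2 ^ k ∸ 3)))
    (trans (cong (λ k → run (binary (2 ^ k ∸ 3))) k≡) (run-2^∸3 M n))
  contradict : ∀ t r →
    (∀ m → onesState M (m ℕ.+ 2 ^ t)
           ≡ onesState M (m ℕ.+ 2 ^ t ℕ.+ 2 ^ suc t ℕ.* (1 ℕ.+ 2 ℕ.* r))) →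
    ∀ k → 6 ℕ.+ t ℕ.+ 2 ^ t ≤ k → ∀ {w} → Odd w → R (+ k) ≡ 2^ℤ t * w → ⊥
  contradict t r periodic k b≤k {w} w-odd R≡ =
    ω-separates t (2 ^ t ℕ.+ g) r {k} {k ℕ.+ h} k≡ refl R≡ w-odd
      (trans (ω-run k (3 ℕ.+ t ℕ.+ (2 ^ t ℕ.+ g)) k≡) (trans
        (cong (λ s → out (step (step s 0b) 1b)) same-state)
        (sym (ω-run (k ℕ.+ h) (3 ℕ.+ t ℕ.+ (2 ^ t ℕ.+ g) ℕ.+ h) (cong (ℕ._+ h) k≡)))))
    where
    h = 2 ^ suc t ℕ.* (1 ℕ.+ 2 ℕ.* r)
    g = k ∸ (6 ℕ.+ t ℕ.+ 2 ^ t)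
    k≡ : k ≡ 6 ℕ.+ t ℕ.+ (2 ^ t ℕ.+ g)
    -- The leading run of ones in 2^k - 3 has length k - 2, hence the 4 in place of 6 in
    -- `same-state`.
    k≡ = trans (sym (ℕ.m+[n∸m]≡n b≤k)) (ℕ.+-assoc (6 ℕ.+ t) (2 ^ t) g)
    regroup : ∀ t x g → 4 ℕ.+ t ℕ.+ (x ℕ.+ g) ≡ 4 ℕ.+ t ℕ.+ g ℕ.+ x
    regroup = ℕ-solve-∀
    same-state : onesState M (4 ℕ.+ t ℕ.+ (2 ^ t ℕ.+ g))
                 ≡ onesState M (4 ℕ.+ t ℕ.+ (2 ^ t ℕ.+ g) ℕ.+ h)
    same-state = trans (cong (onesState M) (regroup t (2 ^ t) g))
      (trans (periodic (4 ℕ.+ t ℕ.+ g))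
             (cong (λ x → onesState M (x ℕ.+ h)) (sym (regroup t (2 ^ t) g))))

theoremA1 : 2-Automatic a × (∀ n → c n ≢ 0ℤ) × ¬ 2-Automatic ω
theoremA1 = a-automatic , c≢0 , ω-not-automatic
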